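{- Let $k\ge2$ and $n$ be integers with $k$ even and $n\ge\frac{9}{32}k^2+\frac14k+1$. Then \[{\rm bal}(n,P_k)=\begin{cases}\left(\frac{k-2}{4}\right)n-\frac{k^2}{32}+\frac18, & \text{for } k\equiv2\pmod 4,\\[1ex] \left(\frac{k-4}{4}\right)n-\frac{k^2}{32}+\frac k8+1, & \text{for } k\equiv0\pmod4,\end{cases}\] and ${\rm Bal}(n,P_k)$ contains only one graph, namely the complete $\left(\frac{k-2}{4},\,n-\frac{k-2}{4}\right)$-split graph if $k\equiv2\pmod4$, and the complete $\left(\frac{k-4}{4},\,n-\frac{k-4}{4}\right)$-split graph plus one edge if $k\equiv0\pmod4$.
   Context: $P_k$ is the path with $k$ edges (and $k+1$ vertices). A complete $(p,q)$-split graph is a graph whose vertex set has a partition $X\cup Y$ with $|X|=p$, $|Y|=q$, $X$ inducing a complete graph $K_p$, $Y$ independent, and all edges between $X$ and $Y$ present (for $p=0$ it is the edgeless graph on $q$ vertices). "Plus one edge" means that a single edge joining two vertices of $Y$ is added. A $2$-coloring $E(K_n)=E(R)\cup E(B)$ is a partition of the edges of $K_n$ into red and blue edges, forming the spanning subgraphs $R$ and $B$; $e(\cdot)$ denotes number of edges. For a graph $G$ with $e(G)$ even, a balanced copy of $G$ is a (not necessarily induced) subgraph of $K_n$ isomorphic to $G$ with exactly $e(G)/2$ red and $e(G)/2$ blue edges. ${\rm bal}(n,G)$ is the minimum non-negative integer $s$ such that every $2$-coloring $E(K_n)=E(R)\cup E(B)$ with $\min\{e(R),e(B)\}>s$ contains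 a balanced copy of $G$. ${\rm Bal}(n,G)$ is the family (up to isomorphism) of $n$-vertex graphs with exactly ${\rm bal}(n,G)$ edges such that a coloring $E(K_n)=E(R)\cup E(B)$ with $\min\{e(R),e(B)\}={\rm bal}(n,G)$ contains no balanced copy of $G$ if and only if $R$ or $B$ is isomorphic to some $H\in{\rm Bal}(n,G)$. -}

module Defs where

open import Data.Fin using (Fin; toℕ; _<?_)
open import Data.Fin.Subset using (Subset; _∈_; ∁; ∣_∣)
open import Data.Integer using (+_)
open import Data.List using (List; length; filter; cartesianProduct; allFin)
open import Data.Nat as ℕ using (ℕ; suc; _*_; _⊓_; _≤_; _≟_)
open import Data.Nat.Properties using (1+n≢n)
open import Data.Product using (Σ-syntax; ∃-syntax; _×_; _,_)
open import Data.Rational.Unnormalised as ℚᵘ using (ℚᵘ)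
open import Data.Sum using (_⊎_; inj₁; inj₂; swap)
open import Function using (_⇔_; _↔_; Injective; Inverse)
open import Level using (0ℓ)
open import Relation.Binary using (Rel; Decidable; Symmetric)
open import Relation.Binary.PropositionalEquality using (_≡_; _≢_; sym)
open import Relation.Nullary using (¬_)
open import Relation.Nullary.Decidable using (_×-dec_; _⊎-dec_)
open import Relation.Unary using (Pred)

record Graph (n : ℕ) : Set₁ where
  field
    _~_     : Rel (Fin n) 0ℓ
    _~?_    : Decidable _~_
    ~-sym   : Symmetric _~_
    ~-irref : ∀ {u} → ¬ (u ~ u)

infix 4 _⊢_~_ _⊢_~?_

_⊢_~_ : ∀ {n} (G : Graph n) → Rel (Fin n) 0ℓ
G ⊢ u ~ v = Graph._~_ G u v

_⊢_~?_ : ∀ {n} (G : Graph n) → Decidable (G ⊢_~_)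
G ⊢ u ~? v = Graph._~?_ G u v

-- Each edge is listed once, with its smaller endpoint first.
edges : ∀ {n} → Graph n → List (Fin n × Fin n)
edges {n} G =
  filter (λ (u , v) → (u <? v) ×-dec (G ⊢ u ~? v))
         (cartesianProduct (allFin n) (allFin n))

e : ∀ {n} → Graph n → ℕ
e G = length (edges G)

infix 4 _≅_

record _≅_ {n : ℕ} (G H : Graph n) : Set where
  field
    bij      : Fin n ↔ Fin n
    preserve : ∀ u v → G ⊢ u ~ v ⇔ H ⊢ Inverse.to bij u ~ Inverse.to bij v

path : (k : ℕ) → Graph (suc k)
path k = record
  { _~_     = λ i j → toℕ j ≡ suc (toℕ i) ⊎ toℕ i ≡ suc (toℕ j)
  ; _~?_    = λ i j → (toℕ j ≟ suc (toℕ i)) ⊎-dec (toℕ i ≟ suc (toℕ j))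
  ; ~-sym   = swap
  ; ~-irref = λ { (inj₁ p) → 1+n≢n (sym p) ; (inj₂ p) → 1+n≢n (sym p) }
  }

-- G is complete split with respect to the vertex partition X ∪ ∁ X.
record SplitsAlong {n : ℕ} (X : Subset n) (G : Graph n) : Set where
  field
    clique      : ∀ {u v} → u ∈ X → v ∈ X → u ≢ v → G ⊢ u ~ v
    independent : ∀ {u v} → u ∈ ∁ X → v ∈ ∁ X → ¬ (G ⊢ u ~ v)
    joined      : ∀ {u v} → u ∈ X → v ∈ ∁ X → G ⊢ u ~ v

IsCompleteSplit : ∀ {n} (p q : ℕ) → Graph n → Set
IsCompleteSplit {n} p q G =
  Σ[ X ∈ Subset n ] ∣ X ∣ ≡ p × ∣ ∁ X ∣ ≡ q × SplitsAlong X G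

record IsCompleteSplitPlusEdge {n : ℕ} (p q : ℕ) (G : Graph n) : Set₁ where
  field
    X      : Subset n
    ∣X∣≡p  : ∣ X ∣ ≡ p
    ∣Y∣≡q  : ∣ ∁ X ∣ ≡ q
    S      : Graph n
    splitS : SplitsAlong X S
    x y    : Fin n
    x∈Y    : x ∈ ∁ X
    y∈Y    : y ∈ ∁ X
    x≢y    : x ≢ y
    adj    : ∀ u v → G ⊢ u ~ v ⇔
               (S ⊢ u ~ v ⊎ (u ≡ x × v ≡ y) ⊎ (u ≡ y × v ≡ x))

record Colouring (n : ℕ) : Set₁ where
  field
    R B      : Graph n
    cover    : ∀ {u v} → u ≢ v → R ⊢ u ~ v ⊎ B ⊢ u ~ v
    disjoint : ∀ {u v} → ¬ (R ⊢ u ~ v × B ⊢ u ~ v)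

open Colouring public using (R; B)

minColour : ∀ {n} → Colouring n → ℕ
minColour C = e (R C) ⊓ e (B C)

-- The number of edges of G that φ sends to edges of H.
edgesInto : ∀ {m n} → Graph m → (Fin m → Fin n) → Graph n → ℕ
edgesInto G φ H =
  length (filter (λ (u , v) → H ⊢ φ u ~? φ v) (edges G))

-- The copies of G in the complete graph are the images of G under injective
-- maps of vertices.
HasBalancedCopy : ∀ {m n} → Graph m → Colouring n → Set
HasBalancedCopy {m} {n} G C =
  Σ[ φ ∈ (Fin m → Fin n) ] Injective _≡_ _≡_ φ
    × 2 * edgesInto G φ (R C) ≡ e G
    × 2 * edgesInto G φ (B C) ≡ e G

Forces : ∀ {m} (n : ℕ) → Graph m → ℕ → Set₁
Forces n G s = (C : Colouring n) → s ℕ.< minColour C → HasBalancedCopy G C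

-- "bal(n,G) = s"
IsBal : ∀ {m} (n : ℕ) → Graph m → ℕ → Set₁
IsBal n G s = Forces n G s × (∀ t → Forces n G t → s ≤ t)

-- "Bal(n,G) = F", where a family of graphs up to isomorphism is given as an
-- isomorphism-invariant predicate.
record IsBalFamily {m : ℕ} (n : ℕ) (G : Graph m) (F : Pred (Graph n) 0ℓ) : Set₁ where
  field
    respects-≅ : ∀ {H K} → H ≅ K → F H → F K
    size       : ∀ {H} → F H → IsBal n G (e H)
    extremal   : (C : Colouring n) → IsBal n G (minColour C) →
                 (¬ HasBalancedCopy G C) ⇔
                 (∃[ H ] F H × (R C ≅ H ⊎ B C ≅ H))

-- "Bal(n,G) contains only one graph, namely S"
BalIsOnly : ∀ {m} (n : ℕ) → Graph m → Graph n → Set₁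
BalIsOnly n G S =
  (F : Pred (Graph n) 0ℓ) → IsBalFamily n G F ⇔ (∀ H → F H ⇔ H ≅ S)

ι : ℕ → ℚᵘ
ι m = + m ℚᵘ./ 1

module Submission where

-- Write k = 2m with m = 2h + 1 + c and c ∈ {0, 1}; the extremal graph is the h-fold cone over an
-- edgeless graph (c = 0) or over a single edge (c = 1).
-- Sliding a path with k edges (drop its first vertex, append another at its end) changes its number of
-- red edges by at most one. If there is a vertex outside the path, sliding connects any two placements
-- of the path, so without a balanced copy all placements have fewer than m red edges, or all have fewer
-- than m blue edges. That colour class then contains no linear forest with m edges, and the Turán problem
-- for linear forests is solved by induction on h: a vertex of degree at least 2m − 2 can be deleted,
-- since it always supplies two further forest edges; if there is none, the edges are so spread out that
-- a matching, or a matching and two more edges, is found greedily.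
-- For k = 2 and n = 3 sliding is not transitive; there a colouring without a balanced copy is
-- monochromatic by direct inspection.

-- A linear forest with m edges and no isolated vertices has at most 2m vertices, one fewer than the
-- path with 2m edges, so in a graph with at least 2m + 1 vertices it extends to a placement of that
-- path. This is why a colour that appears fewer than m times on every placement contains no such
-- forest. In the extremal graph every apex lies on at most two edges of a path and the seed
-- contributes at most c, so at most 2h + c = m - 1 edges of a path fall into it. Hence deleting one
-- vertex has to lower m by exactly 2, and the parity of m decides between the two seeds. The Turán
-- statement is proved directly in its uniqueness form: a graph without the forest and with at least
-- as many edges as the extremal graph is isomorphic to it. Applied to a colour class, this yields
-- both the value of bal and the description of the extremal colourings. What remains is that the
-- complement of the extremal graph has strictly more edges, so that the extremal graph is always
-- the minority colour.

open import Defs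

-- Sums of indicators, degrees, vertex deletion and the pigeonhole principle.

module Counting where

  open import Data.Bool using (true; false; if_then_else_)
  open import Data.Fin using (Fin; zero; suc; punchIn; _<?_)
  open import Data.Fin.Properties using (<-cmp; _≟_; any?; punchInᵢ≢i)
  open import Data.List using (List; []; _∷_; _++_; length; filter; map; tabulate; cartesianProduct)
  open import Data.List.Properties using (filter-++; length-++; map-tabulate)
  open import Data.Nat using (ℕ; zero; suc; _+_; _*_; _≤_; _<_; z≤n; s≤s; z<s)
  open import Data.Nat.Properties hiding (<-cmp; _<?_; _≟_)
  open import Data.Product using (_×_; ∃-syntax; _,_; proj₁; proj₂)
  open import Function using (_∘_; id; _⇔_; Equivalence; mk⇔; Inverse)
  open import Relation.Binary using (tri<; tri≈; tri>)
  open import Relation.Binary.PropositionalEquality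
  open import Relation.Nullary using (Dec; yes; no; does; ¬_; contradiction)
  open import Relation.Nullary.Decidable using (_×-dec_; ¬?; decidable-stable)
  open import Relation.Unary using (Pred; Decidable)
  open import Level using (0ℓ)
  open import Data.Unit using (tt)
  open import Data.List.Membership.Propositional using (_∈_; _∉_)
  import Data.List.Membership.DecPropositional as DecMembership
  open import Algebra.Properties.CommutativeMonoid.Sum +-0-commutativeMonoid public
    using (sum; sum-remove; ∑-distrib-+; ∑-comm; sum-cong-≗; sum-permute; sum-syntax)

  variable
    n : ℕ
    P Q : Set

  ⟦_⟧ : Dec P → ℕ
  ⟦ P? ⟧ = if does P? then 1 else 0

  ⟦⟧-mono : (P? : Dec P) (Q? : Dec Q) → (P → Q) → ⟦ P? ⟧ ≤ ⟦ Q? ⟧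
  ⟦⟧-mono (no _)  _        _   = z≤n
  ⟦⟧-mono (yes _) (yes _)  _   = ≤-refl
  ⟦⟧-mono (yes p) (no ¬q)  p⇒q = contradiction (p⇒q p) ¬q

  ⟦⟧-cong : (P? : Dec P) (Q? : Dec Q) → P ⇔ Q → ⟦ P? ⟧ ≡ ⟦ Q? ⟧
  ⟦⟧-cong P? Q? eq =
    ≤-antisym (⟦⟧-mono P? Q? (Equivalence.to eq)) (⟦⟧-mono Q? P? (Equivalence.from eq))

  ⟦⟧-yes : (P? : Dec P) → P → ⟦ P? ⟧ ≡ 1
  ⟦⟧-yes (yes _) _ = refl
  ⟦⟧-yes (no ¬p) p = contradiction p ¬p

  ⟦⟧-no : (P? : Dec P) → ¬ P → ⟦ P? ⟧ ≡ 0
  ⟦⟧-no (yes p) ¬p = contradiction p ¬p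
  ⟦⟧-no (no _)  _  = refl

  ⟦⟧≤1 : (P? : Dec P) → ⟦ P? ⟧ ≤ 1
  ⟦⟧≤1 (yes _) = ≤-refl
  ⟦⟧≤1 (no _)  = z≤n

  sum-mono : ∀ {n} {f g : Fin n → ℕ} → (∀ i → f i ≤ g i) → sum f ≤ sum g
  sum-mono {zero}  f≤g = z≤n
  sum-mono {suc n} f≤g = +-mono-≤ (f≤g zero) (sum-mono (f≤g ∘ suc))

  sum-const : ∀ n c → sum {n} (λ _ → c) ≡ n * c
  sum-const zero    c = refl
  sum-const (suc n) c = cong (c +_) (sum-const n c)

  sum-ones : ∀ n → sum {n} (λ _ → 1) ≡ n
  sum-ones n = trans (sum-const n 1) (*-identityʳ n)

  module _ {A : Set} {R : Pred A 0ℓ} (R? : Decidable R) where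

    length-filter-∷ : ∀ x xs → length (filter R? (x ∷ xs)) ≡ ⟦ R? x ⟧ + length (filter R? xs)
    length-filter-∷ x xs with R? x
    ... | yes _ = refl
    ... | no  _ = refl

    length-filter-tabulate : (f : Fin n → A) →
      length (filter R? (tabulate f)) ≡ ∑[ i < n ] ⟦ R? (f i) ⟧
    length-filter-tabulate {zero}  f = refl
    length-filter-tabulate {suc n} f =
      trans (length-filter-∷ (f zero) _) (cong (⟦ R? (f zero) ⟧ +_) (length-filter-tabulate (f ∘ suc)))

    length-filter-++ : ∀ xs ys →
      length (filter R? (xs ++ ys)) ≡ length (filter R? xs) + length (filter R? ys)
    length-filter-++ xs ys =
      trans (cong length (filter-++ R? xs ys)) (length-++ (filter R? xs))

  length-filter-product : ∀ {A B : Set} {R : Pred (A × B) 0ℓ} (R? : Decidable R)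
    {m n} (f : Fin m → A) (g : Fin n → B) →
    length (filter R? (cartesianProduct (tabulate f) (tabulate g))) ≡
    ∑[ i < m ] ∑[ j < n ] ⟦ R? (f i , g j) ⟧
  length-filter-product R? {zero}  f g = refl
  length-filter-product R? {suc m} f g = trans (length-filter-++ R? (map (f zero ,_) (tabulate g)) _)
    (cong₂ _+_
      (trans (cong (length ∘ filter R?) (map-tabulate g (f zero ,_)))
             (length-filter-tabulate R? (λ j → f zero , g j)))
      (length-filter-product R? (f ∘ suc) g))

  degree : Graph n → Fin n → ℕ
  degree {n} G v = ∑[ u < n ] ⟦ G ⊢ v ~? u ⟧

  degreeSum : Graph n → ℕ
  degreeSum {n} G = ∑[ v < n ] degree G v

  e≡∑ : (G : Graph n) → e G ≡ ∑[ u < n ] ∑[ v < n ] ⟦ (u <? v) ×-dec (G ⊢ u ~? v) ⟧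
  e≡∑ G = length-filter-product (λ (u , v) → (u <? v) ×-dec (G ⊢ u ~? v)) id id

  -- An adjacency is charged to the order of its endpoints, and the two halves of the double sum
  -- agree after exchanging the summations. Later counts use `degreeSum`, which needs no order on
  -- the endpoints; this is the bridge to `e`.
  handshake : (G : Graph n) → degreeSum G ≡ 2 * e G
  handshake {n} G = begin
    ∑[ u < n ] ∑[ v < n ] ⟦ G ⊢ u ~? v ⟧              ≡⟨ sum-cong-≗ (λ u → sum-cong-≗ (split u)) ⟩
    ∑[ u < n ] ∑[ v < n ] (up u v + up v u)            ≡⟨ sum-cong-≗ (λ u → ∑-distrib-+ (up u) (λ v → up v u)) ⟩
    ∑[ u < n ] (∑[ v < n ] up u v + ∑[ v < n ] up v u)  ≡⟨ ∑-distrib-+ (λ u → ∑[ v < n ] up u v) _ ⟩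
    E + ∑[ u < n ] ∑[ v < n ] up v u                   ≡⟨ cong (E +_) (∑-comm (λ u v → up v u)) ⟩
    E + E                                              ≡⟨ cong (E +_) (+-identityʳ E) ⟨
    2 * E                                              ≡⟨ cong (2 *_) (e≡∑ G) ⟨
    2 * e G                                            ∎
    where
    open ≡-Reasoning
    up : Fin n → Fin n → ℕ
    up u v = ⟦ (u <? v) ×-dec (G ⊢ u ~? v) ⟧
    E = ∑[ u < n ] ∑[ v < n ] up u v
    split : ∀ u v → ⟦ G ⊢ u ~? v ⟧ ≡ up u v + up v u
    split u v with <-cmp u v
    ... | tri< u<v _ v≮u = sym (trans
      (cong₂ _+_ (⟦⟧-cong ((u <? v) ×-dec (G ⊢ u ~? v)) (G ⊢ u ~? v) (mk⇔ proj₂ (u<v ,_)))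
                 (⟦⟧-no ((v <? u) ×-dec (G ⊢ v ~? u)) (v≮u ∘ proj₁)))
      (+-identityʳ _))
    ... | tri≈ _ refl _  = trans (⟦⟧-no (G ⊢ u ~? u) (Graph.~-irref G))
      (sym (cong₂ _+_ none none))
      where none = ⟦⟧-no ((u <? u) ×-dec (G ⊢ u ~? u)) (Graph.~-irref G ∘ proj₂)
    ... | tri> u≮v _ v<u = sym (cong₂ _+_
      (⟦⟧-no ((u <? v) ×-dec (G ⊢ u ~? v)) (u≮v ∘ proj₁))
      (⟦⟧-cong ((v <? u) ×-dec (G ⊢ v ~? u)) (G ⊢ u ~? v)
        (mk⇔ (Graph.~-sym G ∘ proj₂) (λ u~v → v<u , Graph.~-sym G u~v))))

  infixl 6 _∖_

  _∖_ : Graph (suc n) → Fin (suc n) → Graph n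
  G ∖ v = record
    { _~_     = λ x y → G ⊢ punchIn v x ~ punchIn v y
    ; _~?_    = λ x y → G ⊢ punchIn v x ~? punchIn v y
    ; ~-sym   = Graph.~-sym G
    ; ~-irref = Graph.~-irref G
    }

  degree-punchIn : (G : Graph (suc n)) (v : Fin (suc n)) →
    degree G v ≡ ∑[ u < n ] ⟦ G ⊢ v ~? punchIn v u ⟧
  degree-punchIn {n} G v = trans (sum-remove {i = v} (λ u → ⟦ G ⊢ v ~? u ⟧))
    (cong (_+ ∑[ u < n ] ⟦ G ⊢ v ~? punchIn v u ⟧) (⟦⟧-no (G ⊢ v ~? v) (Graph.~-irref G)))

  degree-∖ : (G : Graph (suc n)) (v : Fin (suc n)) (u : Fin n) →
    degree G (punchIn v u) ≡ ⟦ G ⊢ v ~? punchIn v u ⟧ + degree (G ∖ v) u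
  degree-∖ G v u = trans (sum-remove {i = v} (λ w → ⟦ G ⊢ punchIn v u ~? w ⟧))
    (cong (_+ degree (G ∖ v) u)
      (⟦⟧-cong (G ⊢ punchIn v u ~? v) (G ⊢ v ~? punchIn v u) (mk⇔ (Graph.~-sym G) (Graph.~-sym G))))

  degree-∖-≤ : (G : Graph (suc n)) (v : Fin (suc n)) (u : Fin n) →
    degree (G ∖ v) u ≤ degree G (punchIn v u)
  degree-∖-≤ G v u = ≤-trans (m≤n+m _ ⟦ G ⊢ v ~? punchIn v u ⟧) (≤-reflexive (sym (degree-∖ G v u)))

  degreeSum-∖ : (G : Graph (suc n)) (v : Fin (suc n)) →
    degreeSum G ≡ 2 * degree G v + degreeSum (G ∖ v)
  degreeSum-∖ {n} G v = begin
    degreeSum G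
      ≡⟨ sum-remove {i = v} (degree G) ⟩
    d + ∑[ u < n ] degree G (punchIn v u)
      ≡⟨ cong (d +_) (sum-cong-≗ (degree-∖ G v)) ⟩
    d + ∑[ u < n ] (⟦ G ⊢ v ~? punchIn v u ⟧ + degree (G ∖ v) u)
      ≡⟨ cong (d +_) (∑-distrib-+ (λ u → ⟦ G ⊢ v ~? punchIn v u ⟧) (degree (G ∖ v))) ⟩
    d + (∑[ u < n ] ⟦ G ⊢ v ~? punchIn v u ⟧ + degreeSum (G ∖ v))
      ≡⟨ cong (λ x → d + (x + degreeSum (G ∖ v))) (degree-punchIn G v) ⟨
    d + (d + degreeSum (G ∖ v))
      ≡⟨ +-assoc d d _ ⟨
    d + d + degreeSum (G ∖ v)
      ≡⟨ cong (λ x → d + x + degreeSum (G ∖ v)) (+-identityʳ d) ⟨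
    2 * d + degreeSum (G ∖ v)
      ∎
    where
    open ≡-Reasoning
    d = degree G v

  degreeSum-≅ : {G H : Graph n} → G ≅ H → degreeSum G ≡ degreeSum H
  degreeSum-≅ {n} {G} {H} i = sym (begin
    degreeSum H                                    ≡⟨ sum-permute (degree H) π ⟩
    ∑[ u < n ] degree H (to u)                     ≡⟨ sum-cong-≗ (λ u → sum-permute (λ w → ⟦ H ⊢ to u ~? w ⟧) π) ⟩
    ∑[ u < n ] ∑[ v < n ] ⟦ H ⊢ to u ~? to v ⟧     ≡⟨ sum-cong-≗ (λ u → sum-cong-≗ (λ v →
                                                       ⟦⟧-cong (G ⊢ u ~? v) (H ⊢ to u ~? to v) (_≅_.preserve i u v))) ⟨
    degreeSum G                                    ∎)
    where
    open ≡-Reasoning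
    π = _≅_.bij i
    to = Inverse.to π

  sum-positive : ∀ {n} (f : Fin n → ℕ) → 0 < sum f → ∃[ i ] 0 < f i
  sum-positive {suc n} f 0<∑ with f zero in eq
  ... | suc x = zero , subst (0 <_) (sym eq) z<s
  ... | zero  = let i , 0<fi = sum-positive (f ∘ suc) 0<∑ in suc i , 0<fi

  ⟦⟧-positive : (P? : Dec P) → 0 < ⟦ P? ⟧ → P
  ⟦⟧-positive (yes p) _ = p

  findEdge : (G : Graph n) → 0 < degreeSum G → ∃[ u ] ∃[ v ] G ⊢ u ~ v
  findEdge G 0<∑ =
    let u , 0<d = sum-positive (degree G) 0<∑
        v , 0<i = sum-positive (λ v → ⟦ G ⊢ u ~? v ⟧) 0<d
    in u , v , ⟦⟧-positive (G ⊢ u ~? v) 0<i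

  _∈?_ : (x : Fin n) (l : List (Fin n)) → Dec (x ∈ l)
  _∈?_ = DecMembership._∈?_ _≟_

  ∑-≟ : ∀ {n} (y : Fin n) → ∑[ x < n ] ⟦ x ≟ y ⟧ ≡ 1
  ∑-≟ {suc n} y = begin
    ∑[ x < suc n ] ⟦ x ≟ y ⟧                 ≡⟨ sum-remove {i = y} (λ x → ⟦ x ≟ y ⟧) ⟩
    ⟦ y ≟ y ⟧ + ∑[ x < n ] ⟦ punchIn y x ≟ y ⟧
      ≡⟨ cong₂ _+_ (⟦⟧-yes (y ≟ y) refl) (sum-cong-≗ (λ x → ⟦⟧-no (punchIn y x ≟ y) (punchInᵢ≢i y x))) ⟩
    1 + ∑[ x < n ] 0                         ≡⟨ cong (1 +_) (trans (sum-const n 0) (*-zeroʳ n)) ⟩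
    1                                        ∎
    where open ≡-Reasoning

  ∑-∈≤length : (l : List (Fin n)) → ∑[ x < n ] ⟦ x ∈? l ⟧ ≤ length l
  ∑-∈≤length {n} []      = ≤-reflexive (trans (sum-const n 0) (*-zeroʳ n))
  ∑-∈≤length {n} (y ∷ l) = begin
    ∑[ x < n ] ⟦ x ∈? (y ∷ l) ⟧                         ≤⟨ sum-mono split ⟩
    ∑[ x < n ] (⟦ x ≟ y ⟧ + ⟦ x ∈? l ⟧)               ≡⟨ ∑-distrib-+ (λ x → ⟦ x ≟ y ⟧) _ ⟩
    ∑[ x < n ] ⟦ x ≟ y ⟧ + ∑[ x < n ] ⟦ x ∈? l ⟧      ≤⟨ +-mono-≤ (≤-reflexive (∑-≟ y)) (∑-∈≤length l) ⟩
    suc (length l)                                    ∎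
    where
    open ≤-Reasoning
    split : ∀ x → ⟦ x ∈? (y ∷ l) ⟧ ≤ ⟦ x ≟ y ⟧ + ⟦ x ∈? l ⟧
    split x with does (x ≟ y) | does (x ∈? l)
    ... | true  | _     = s≤s z≤n
    ... | false | true  = ≤-refl
    ... | false | false = z≤n

  -- Pigeonhole: if every `x` with `R x` occurred in `l`, the indicator sum would be at most
  -- `length l`.
  fresh : {R : Pred (Fin n) 0ℓ} (R? : Decidable R) (l : List (Fin n)) →
    length l < ∑[ x < n ] ⟦ R? x ⟧ → ∃[ x ] R x × x ∉ l
  fresh {n} R? l l<∑ with any? (λ x → R? x ×-dec ¬? (x ∈? l))
  ... | yes found = found
  ... | no  none  = contradiction (<-≤-trans l<∑ (≤-trans (sum-mono covered) (∑-∈≤length l))) (<-irrefl refl)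
    where
    covered : ∀ x → ⟦ R? x ⟧ ≤ ⟦ x ∈? l ⟧
    covered x = ⟦⟧-mono (R? x) (x ∈? l) (λ r → decidable-stable (x ∈? l) (λ x∉l → none (x , r , x∉l)))

  freshVertex : (l : List (Fin n)) → length l < n → ∃[ x ] x ∉ l
  freshVertex {n} l l<n =
    let x , _ , x∉l = fresh (λ _ → yes tt) l (subst (length l <_) (sym (sum-ones n)) l<n)
    in x , x∉l

-- Linear forests encoded as vertex lists, and three ways to enlarge them.

module Forests where

  open Counting
  open import Data.Fin using (Fin; zero; suc; punchIn; punchOut)
  open import Data.Fin.Properties using (any?; punchIn-injective; punchInᵢ≢i; punchIn-punchOut)
  open import Data.List using (List; []; _∷_; length; map)
  open import Data.List.Properties using (length-map)
  open import Data.List.Relation.Unary.All using (All; []; _∷_)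
  import Data.List.Relation.Unary.All as All
  import Data.List.Relation.Unary.All.Properties as All
  open import Data.List.Relation.Unary.AllPairs using ([]; _∷_)
  open import Data.List.Relation.Unary.Any using (here; there)
  open import Data.List.Relation.Unary.Unique.Propositional using (Unique)
  import Data.List.Relation.Unary.Unique.Propositional.Properties as Unique
  open import Data.Nat using (ℕ; zero; suc; _+_; _*_; _≤_; _<_; z≤n; s≤s; s≤s⁻¹; _≤?_)
  open import Data.Nat.Properties hiding (_≟_; _≤?_)
  open import Data.Nat.Tactic.RingSolver using (solve-∀)
  open import Data.Product using (_×_; ∃-syntax; _,_; proj₁; proj₂)
  open import Function using (_∘_; id; _⇔_; mk⇔)
  open import Relation.Binary.PropositionalEquality
  open import Relation.Nullary using (yes; no; contradiction)

  variable
    m : ℕ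

  -- A certificate for linear inequalities: y - x equals (b - a) + r, with `r` the slack. The known
  -- inequalities are added up into `a ≤ b`, and the ring solver checks the equation.
  ≤-from : ∀ {a b x y} r → a ≤ b → x + b + r ≡ y + a → x ≤ y
  ≤-from {a} {b} {x} {y} r a≤b eq = +-cancelʳ-≤ a x y (begin
    x + a      ≤⟨ +-monoʳ-≤ x a≤b ⟩
    x + b      ≤⟨ m≤m+n (x + b) r ⟩
    x + b + r  ≡⟨ eq ⟩
    y + a ∎)
    where open ≤-Reasoning

  along : Graph n → List (Fin n) → ℕ
  along G []          = 0
  along G (x ∷ [])    = 0
  along G (x ∷ y ∷ l) = ⟦ G ⊢ x ~? y ⟧ + along G (y ∷ l)

  along≤along-∷ : (G : Graph n) (x : Fin n) (l : List (Fin n)) → along G l ≤ along G (x ∷ l)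
  along≤along-∷ G x []      = z≤n
  along≤along-∷ G x (y ∷ l) = m≤n+m _ _

  along-map : (G : Graph m) (H : Graph n) (f : Fin m → Fin n) →
    (∀ x y → G ⊢ x ~ y ⇔ H ⊢ f x ~ f y) → ∀ l → along H (map f l) ≡ along G l
  along-map G H f f⇔ []          = refl
  along-map G H f f⇔ (x ∷ [])    = refl
  along-map G H f f⇔ (x ∷ y ∷ l) =
    sym (cong₂ _+_ (⟦⟧-cong (G ⊢ x ~? y) (H ⊢ f x ~? f y) (f⇔ x y)) (sym (along-map G H f f⇔ (y ∷ l))))

  along-punchIn : (G : Graph (suc n)) (v : Fin (suc n)) (l : List (Fin n)) →
    along G (map (punchIn v) l) ≡ along (G ∖ v) l
  along-punchIn G v = along-map (G ∖ v) G (punchIn v) (λ _ _ → mk⇔ id id)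

  -- A linear forest is given by a list of vertices running through its components one after another.
  Forest : ℕ → Graph n → Set
  Forest {n} m G = ∃[ l ] Unique l × length l ≤ 2 * m × m ≤ along G l

  unique-punchIn : (v : Fin (suc n)) {l : List (Fin n)} → Unique l → Unique (v ∷ map (punchIn v) l)
  unique-punchIn v {l} u =
    All.map⁺ (All.universal (λ x → punchInᵢ≢i v x ∘ sym) l) ∷ Unique.map⁺ (punchIn-injective v _ _) u

  edge⇒along : (G : Graph n) {x y : Fin n} (l : List (Fin n)) → G ⊢ x ~ y →
    along G (x ∷ y ∷ l) ≡ suc (along G (y ∷ l))
  edge⇒along G {x} {y} l x~y = cong (_+ along G (y ∷ l)) (⟦⟧-yes (G ⊢ x ~? y) x~y)

  -- The pair is put in front of the old list. Should the junction between the two happen to be an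
  -- edge, the count only grows.
  extendByEdge : (G : Graph (suc (suc n))) (a : Fin (suc (suc n))) (b : Fin (suc n)) →
    G ⊢ a ~ punchIn a b → Forest m (G ∖ a ∖ b) → Forest (suc m) G
  extendByEdge {m = m} G a b a~b (l , u , len , m≤) =
    a ∷ map (punchIn a) (b ∷ map (punchIn b) l) ,
    unique-punchIn a (unique-punchIn b u) ,
    ≤-trans
      (≤-reflexive (cong suc (trans (length-map (punchIn a) (b ∷ map (punchIn b) l))
                                    (cong suc (length-map (punchIn b) l)))))
      (≤-trans (s≤s (s≤s len)) (≤-reflexive (cong suc (sym (+-suc m (m + 0)))))) ,
    (begin
      suc m
        ≤⟨ s≤s m≤ ⟩
      suc (along (G ∖ a ∖ b) l)
        ≡⟨ cong suc (along-punchIn (G ∖ a) b l) ⟨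
      suc (along (G ∖ a) (map (punchIn b) l))
        ≤⟨ s≤s (along≤along-∷ (G ∖ a) b (map (punchIn b) l)) ⟩
      suc (along (G ∖ a) (b ∷ map (punchIn b) l))
        ≡⟨ cong suc (along-punchIn G a (b ∷ map (punchIn b) l)) ⟨
      suc (along G (map (punchIn a) (b ∷ map (punchIn b) l)))
        ≡⟨ edge⇒along G (map (punchIn a) (map (punchIn b) l)) a~b ⟨
      along G (a ∷ map (punchIn a) (b ∷ map (punchIn b) l)) ∎)
    where open ≤-Reasoning

  -- The old list occupies at most `2 * m` neighbours of `v`, so two neighbours `a` and `b` are
  -- left, and a, v, b go in front of it. Three new vertices for two new edges leave a slack of 1 in
  -- the bound on the length.
  extendByCherry : (G : Graph (suc n)) (v : Fin (suc n)) → 2 * m + 2 ≤ degree G v →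
    Forest m (G ∖ v) → Forest (2 + m) G
  extendByCherry {n} {m} G v 2m+2≤d (l , u , len , m≤) =
    punchIn v a ∷ v ∷ punchIn v b ∷ map (punchIn v) l ,
    unique ,
    ≤-trans (s≤s (s≤s (s≤s (≤-trans (≤-reflexive (length-map (punchIn v) l)) len))))
      (≤-from {0} 1 z≤n (lengths m)) ,
    (begin
      2 + m
        ≤⟨ +-monoʳ-≤ 2 m≤ ⟩
      2 + along (G ∖ v) l
        ≡⟨ cong (2 +_) (along-punchIn G v l) ⟨
      2 + along G (map (punchIn v) l)
        ≤⟨ +-monoʳ-≤ 2 (along≤along-∷ G (punchIn v b) (map (punchIn v) l)) ⟩
      2 + along G (punchIn v b ∷ map (punchIn v) l)
        ≡⟨ cong suc (edge⇒along G (map (punchIn v) l) v~b) ⟨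
      1 + along G (v ∷ punchIn v b ∷ map (punchIn v) l)
        ≡⟨ edge⇒along G (punchIn v b ∷ map (punchIn v) l) (Graph.~-sym G v~a) ⟨
      along G (punchIn v a ∷ v ∷ punchIn v b ∷ map (punchIn v) l) ∎)
    where
    open ≤-Reasoning
    nbrs : 2 * m + 2 ≤ ∑[ x < n ] ⟦ G ⊢ v ~? punchIn v x ⟧
    nbrs = subst (2 * m + 2 ≤_) (degree-punchIn G v) 2m+2≤d
    1+l< : suc (suc (length l)) ≤ 2 * m + 2
    1+l< = ≤-trans (s≤s (s≤s len)) (≤-reflexive (+-comm 2 (2 * m)))
    pickA = fresh (λ x → G ⊢ v ~? punchIn v x) l (<-≤-trans (n<1+n _) (≤-trans (n≤1+n _) (≤-trans 1+l< nbrs)))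
    a = proj₁ pickA
    v~a = proj₁ (proj₂ pickA)
    a∉l = proj₂ (proj₂ pickA)
    pickB = fresh (λ x → G ⊢ v ~? punchIn v x) (a ∷ l) (≤-trans 1+l< nbrs)
    b = proj₁ pickB
    v~b = proj₁ (proj₂ pickB)
    b∉a∷l = proj₂ (proj₂ pickB)
    lengths : ∀ m → 3 + 2 * m + 0 + 1 ≡ 2 * (2 + m) + 0
    lengths = solve-∀
    a∷b∷l : Unique (a ∷ b ∷ l)
    a∷b∷l = ((λ a≡b → b∉a∷l (here (sym a≡b))) ∷ All.¬Any⇒All¬ l a∉l) ∷ All.¬Any⇒All¬ l (b∉a∷l ∘ there) ∷ u
    unique : Unique (punchIn v a ∷ v ∷ punchIn v b ∷ map (punchIn v) l)
    unique with unique-punchIn v a∷b∷l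
    ... | (v≢a ∷ v∉) ∷ a∉ ∷ rest = ((v≢a ∘ sym) ∷ a∉) ∷ v∉ ∷ rest

  -- Removing an edge ab loses at most 2D − 1 edges when all degrees are at most D = 1 + d.
  peelEdges : ∀ r → 1 ≤ r → (∀ {n} (H : Graph n) → 2 * r ≤ degreeSum H → Forest r H) →
    ∀ d j {n} (G : Graph n) → (∀ v → degree G v ≤ suc d) →
    2 * (j * suc (2 * d) + r) ≤ degreeSum G → Forest (j + r) G
  peelEdges r 1≤r base d zero    G deg≤ enough = base G enough
  peelEdges r 1≤r base d (suc j) G deg≤ enough with findEdge G
    (≤-trans 1≤r (≤-trans (m≤n+m r (suc j * suc (2 * d))) (≤-trans (m≤m+n (suc j * suc (2 * d) + r) _) enough)))
  peelEdges r 1≤r base d (suc j) {suc zero}    G deg≤ enough | zero , zero , a~a = contradiction a~a (Graph.~-irref G)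
  peelEdges r 1≤r base d (suc j) {suc (suc n)} G deg≤ enough | a , b , a~b =
    extendByEdge G a b′ a~b′ (peelEdges r 1≤r base d j (G ∖ a ∖ b′) deg≤′
      (≤-from 0
        (≤-trans (≤-trans enough (≤-reflexive total))
                 (+-mono-≤ (*-monoʳ-≤ 2 (deg≤ a)) (+-monoˡ-≤ _ (*-monoʳ-≤ 2 degb′))))
        (count d (j * suc (2 * d)) r (degreeSum (G ∖ a ∖ b′)))))
    where
    a≢b : a ≢ b
    a≢b refl = Graph.~-irref G a~b
    b′ = punchOut a≢b
    b≡ : punchIn a b′ ≡ b
    b≡ = punchIn-punchOut a≢b
    a~b′ : G ⊢ a ~ punchIn a b′
    a~b′ = subst (G ⊢ a ~_) (sym b≡) a~b
    -- With `a` gone, the other endpoint has already lost the edge between them; this is what saves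
    -- one of the 2D edges.
    degb′ : degree (G ∖ a) b′ ≤ d
    degb′ = s≤s⁻¹ (≤-trans (≤-reflexive (sym one+)) (deg≤ _))
      where
      one+ : degree G (punchIn a b′) ≡ suc (degree (G ∖ a) b′)
      one+ = trans (degree-∖ G a b′) (cong (_+ degree (G ∖ a) b′) (⟦⟧-yes (G ⊢ a ~? punchIn a b′) a~b′))
    deg≤′ : ∀ v → degree (G ∖ a ∖ b′) v ≤ suc d
    deg≤′ v = ≤-trans (degree-∖-≤ (G ∖ a) b′ v) (≤-trans (degree-∖-≤ G a (punchIn b′ v)) (deg≤ _))
    total : degreeSum G ≡ 2 * degree G a + (2 * degree (G ∖ a) b′ + degreeSum (G ∖ a ∖ b′))
    total = trans (degreeSum-∖ G a) (cong (2 * degree G a +_) (degreeSum-∖ (G ∖ a) b′))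
    count : ∀ d x r s → 2 * (x + r) + (2 * suc d + (2 * d + s)) + 0 ≡ s + 2 * (suc (2 * d) + x + r)
    count = solve-∀

  oneEdge : (G : Graph n) → 2 ≤ degreeSum G → Forest 1 G
  oneEdge G 2≤∑ with findEdge G (≤-trans (n≤1+n 1) 2≤∑)
  ... | a , b , a~b = a ∷ b ∷ [] , ((λ { refl → Graph.~-irref G a~b }) ∷ []) ∷ [] ∷ [] , ≤-refl ,
    ≤-reflexive (sym (edge⇒along G [] a~b))

  -- Any two edges form a linear forest: a cherry at a vertex of degree 2 or more, otherwise a
  -- matching, where removing an edge costs that edge alone. Serving as `base` of `peelEdges`, it
  -- gets the last two edges for two instead of paying the degree bound for each.
  twoEdges : (G : Graph n) → 4 ≤ degreeSum G → Forest 2 G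
  twoEdges {n} G 4≤∑ with any? (λ v → 2 ≤? degree G v)
  ... | no ¬2≤ = peelEdges 1 ≤-refl oneEdge 0 1 G (λ v → s≤s⁻¹ (≰⇒> (λ 2≤ → ¬2≤ (v , 2≤)))) 4≤∑
  twoEdges {suc n} G 4≤∑ | yes (v , 2≤) = extendByCherry G v 2≤ ([] , [] , z≤n , z≤n)

-- Complete split graphs as iterated cones: edge counts, paths through them, isomorphisms.

module SplitGraphs where

  open Counting
  open Forests
  open import Data.Empty using (⊥)
  open import Data.Fin using (Fin; zero; suc; punchIn; punchOut)
  open import Data.Fin.Permutation using (Permutation; _⟨$⟩ʳ_; insert; insert-punchIn)
  import Data.Fin.Permutation as Perm
  open import Data.Fin.Properties using (_≟_; punchIn-punchOut)
  open import Data.List using (List; []; _∷_; _++_; map)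
  open import Data.List.Membership.Propositional.Properties using (∈-∃++)
  open import Data.List.Relation.Unary.All using (All; []; _∷_)
  import Data.List.Relation.Unary.All as All
  import Data.List.Relation.Unary.All.Properties as All
  open import Data.List.Relation.Unary.AllPairs using ([]; _∷_)
  open import Data.List.Relation.Unary.Unique.Propositional using (Unique)
  import Data.List.Relation.Unary.Unique.Propositional.Properties as Unique
  open import Data.Nat using (ℕ; zero; suc; _+_; _*_; _≤_; z≤n; s≤s)
  open import Data.Nat.Properties hiding (_≟_; _≤?_)
  open import Data.Nat.Tactic.RingSolver using (solve-∀)
  open import Data.Product using (_×_; ∃-syntax; _,_)
  open import Data.Sum using (_⊎_; inj₁; inj₂; [_,_])
  open import Data.Unit using (⊤; tt)
  open import Function using (_∘_; id; _⇔_; mk⇔; Inverse)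
  open import Function.Construct.Composition using (_⇔-∘_; _↔-∘_)
  open import Function.Construct.Identity using (↔-id)
  open import Function.Construct.Symmetry using (⇔-sym; ↔-sym)
  open import Relation.Binary.PropositionalEquality hiding ([_])
  open import Relation.Nullary using (Dec; yes; no; ¬_; contradiction)

  ≅-refl : {G : Graph n} → G ≅ G
  ≅-refl = record { bij = ↔-id _ ; preserve = λ _ _ → mk⇔ id id }

  ≅-trans : {G H K : Graph n} → G ≅ H → H ≅ K → G ≅ K
  ≅-trans i j = record
    { bij      = _≅_.bij j ↔-∘ _≅_.bij i
    ; preserve = λ u v → _≅_.preserve j _ _ ⇔-∘ _≅_.preserve i u v
    }

  ≅-sym : {G H : Graph n} → G ≅ H → H ≅ G
  ≅-sym {G = G} {H} i = record
    { bij      = ↔-sym π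
    ; preserve = λ u v → ⇔-sym (subst₂ (λ x y → G ⊢ from u ~ from v ⇔ H ⊢ x ~ y)
        (Perm.inverseʳ π) (Perm.inverseʳ π) (_≅_.preserve i (from u) (from v)))
    }
    where
    π = _≅_.bij i
    from = Inverse.from π

  module _ {n : ℕ} (G : Graph n) where

    coneAdj : Fin (suc n) → Fin (suc n) → Set
    coneAdj zero    zero    = ⊥
    coneAdj zero    (suc v) = ⊤
    coneAdj (suc u) zero    = ⊤
    coneAdj (suc u) (suc v) = G ⊢ u ~ v

    coneAdj? : ∀ u v → Dec (coneAdj u v)
    coneAdj? zero    zero    = no λ ()
    coneAdj? zero    (suc v) = yes tt
    coneAdj? (suc u) zero    = yes tt
    coneAdj? (suc u) (suc v) = G ⊢ u ~? v

    coneAdj-sym : ∀ {u v} → coneAdj u v → coneAdj v u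
    coneAdj-sym {zero}  {suc v} _   = tt
    coneAdj-sym {suc u} {zero}  _   = tt
    coneAdj-sym {suc u} {suc v} u~v = Graph.~-sym G u~v

    coneAdj-irref : ∀ {u} → ¬ coneAdj u u
    coneAdj-irref {suc u} u~u = Graph.~-irref G u~u

    cone : Graph (suc n)
    cone = record
      { _~_ = coneAdj ; _~?_ = coneAdj?
      ; ~-sym = λ {u} {v} → coneAdj-sym {u} {v} ; ~-irref = λ {u} → coneAdj-irref {u} }

  edgeless : Graph n
  edgeless = record { _~_ = λ _ _ → ⊥ ; _~?_ = λ _ _ → no λ () ; ~-sym = λ () ; ~-irref = λ () }

  -- The single edge joins the first two vertices, if there are that many.
  oneEdgeAdj : Fin n → Fin n → Set
  oneEdgeAdj zero       (suc zero) = ⊤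
  oneEdgeAdj (suc zero) zero       = ⊤
  oneEdgeAdj _          _          = ⊥

  oneEdgeAdj? : (u v : Fin n) → Dec (oneEdgeAdj u v)
  oneEdgeAdj? zero          zero          = no λ ()
  oneEdgeAdj? zero          (suc zero)    = yes tt
  oneEdgeAdj? zero          (suc (suc v)) = no λ ()
  oneEdgeAdj? (suc zero)    zero          = yes tt
  oneEdgeAdj? (suc zero)    (suc v)       = no λ ()
  oneEdgeAdj? (suc (suc u)) v             = no λ ()

  oneEdgeAdj-sym : {u v : Fin n} → oneEdgeAdj u v → oneEdgeAdj v u
  oneEdgeAdj-sym {u = zero}     {suc zero} _ = tt
  oneEdgeAdj-sym {u = suc zero} {zero}     _ = tt

  oneEdgeAdj-irref : {u : Fin n} → ¬ oneEdgeAdj u u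
  oneEdgeAdj-irref {u = zero}     ()
  oneEdgeAdj-irref {u = suc zero} ()

  singleEdge : Graph n
  singleEdge = record
    { _~_ = oneEdgeAdj ; _~?_ = oneEdgeAdj?
    ; ~-sym = λ {u} {v} → oneEdgeAdj-sym {u = u} {v} ; ~-irref = λ {u} → oneEdgeAdj-irref {u = u} }

  -- Only c = 0 and c = 1 are meant.
  seed : ℕ → (n : ℕ) → Graph n
  seed zero    n = edgeless
  seed (suc _) n = singleEdge

  -- The apexes form the clique and the seed carries the other side. Building the graph by cones
  -- makes the deletion of the vertex `zero` the induction step; agreement with the definition by a
  -- vertex partition is shown separately.
  splitGraph : (c h n : ℕ) → Graph (h + n)
  splitGraph c zero    n = seed c n
  splitGraph c (suc h) n = cone (splitGraph c h n)

  sum-zero : ∀ n → sum {n} (λ _ → 0) ≡ 0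
  sum-zero n = trans (sum-const n 0) (*-zeroʳ n)

  degreeSum-seed : ∀ c n → c ≤ 1 → 2 * c ≤ n → degreeSum (seed c n) ≡ 2 * c
  degreeSum-seed zero n _ _ = trans (sum-cong-≗ {n} (λ _ → sum-zero n)) (sum-zero n)
  degreeSum-seed (suc zero) (suc (suc n)) _ _ = cong₂ (λ x y → suc x + suc y) (sum-zero n)
    (trans (cong₂ _+_ (sum-zero n) (sum-cong-≗ {n} (λ _ → sum-zero n))) (sum-zero n))
  degreeSum-seed (suc zero) (suc zero) _ (s≤s ())
  degreeSum-seed (suc (suc c)) n (s≤s ()) _

  degreeSum-cone : (G : Graph n) → degreeSum (cone G) ≡ 2 * n + degreeSum G
  degreeSum-cone {n} G = trans (degreeSum-∖ (cone G) zero)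
    (cong (λ d → 2 * d + degreeSum G) (sum-ones n))

  -- With N = h + n vertices this is twice hN - h(h + 1)/2 + c, the subtracted term being moved to
  -- the left.
  degreeSum-splitGraph : ∀ c h n → c ≤ 1 → 2 * c ≤ n →
    degreeSum (splitGraph c h n) + h * suc h ≡ 2 * (h * (h + n)) + 2 * c
  degreeSum-splitGraph c zero    n c≤1 2c≤n = trans (+-identityʳ _) (degreeSum-seed c n c≤1 2c≤n)
  degreeSum-splitGraph c (suc h) n c≤1 2c≤n = begin
    degreeSum (cone S) + suc h * suc (suc h)           ≡⟨ cong (_+ suc h * suc (suc h)) (degreeSum-cone S) ⟩
    2 * (h + n) + degreeSum S + suc h * suc (suc h)    ≡⟨ regroup h n (degreeSum S) ⟩
    2 * (h + suc h + n) + (degreeSum S + h * suc h)    ≡⟨ cong (2 * (h + suc h + n) +_) (degreeSum-splitGraph c h n c≤1 2c≤n) ⟩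
    2 * (h + suc h + n) + (2 * (h * (h + n)) + 2 * c)  ≡⟨ expand h n c ⟩
    2 * (suc h * (suc h + n)) + 2 * c                  ∎
    where
    open ≡-Reasoning
    S = splitGraph c h n
    regroup : ∀ h n s → 2 * (h + n) + s + suc h * suc (suc h) ≡ 2 * (h + suc h + n) + (s + h * suc h)
    regroup = solve-∀
    expand : ∀ h n c → 2 * (h + suc h + n) + (2 * (h * (h + n)) + 2 * c) ≡ 2 * (suc h * (suc h + n)) + 2 * c
    expand = solve-∀

  -- The inserted vertex belongs to at most two consecutive pairs; the pair that it separates counts
  -- in favour of the right-hand side.
  along-insert : (G : Graph n) (v : Fin n) (xs ys : List (Fin n)) →
    along G (xs ++ v ∷ ys) ≤ 2 + along G (xs ++ ys)
  along-insert G v []           []       = z≤n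
  along-insert G v []           (y ∷ ys) = +-mono-≤ (≤-trans (⟦⟧≤1 (G ⊢ v ~? y)) (n≤1+n 1)) ≤-refl
  along-insert G v (x ∷ [])     []       = +-mono-≤ (≤-trans (⟦⟧≤1 (G ⊢ x ~? v)) (n≤1+n 1)) z≤n
  along-insert G v (x ∷ [])     (y ∷ ys) = +-mono-≤ (⟦⟧≤1 (G ⊢ x ~? v))
    (+-mono-≤ (⟦⟧≤1 (G ⊢ v ~? y)) (m≤n+m (along G (y ∷ ys)) ⟦ G ⊢ x ~? y ⟧))
  along-insert G v (x ∷ z ∷ xs) ys = begin
    ⟦ G ⊢ x ~? z ⟧ + along G (z ∷ xs ++ v ∷ ys)    ≤⟨ +-monoʳ-≤ ⟦ G ⊢ x ~? z ⟧ (along-insert G v (z ∷ xs) ys) ⟩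
    ⟦ G ⊢ x ~? z ⟧ + (2 + along G (z ∷ xs ++ ys))  ≡⟨ swap ⟦ G ⊢ x ~? z ⟧ (along G (z ∷ xs ++ ys)) ⟩
    2 + (⟦ G ⊢ x ~? z ⟧ + along G (z ∷ xs ++ ys))  ∎
    where
    open ≤-Reasoning
    swap : ∀ a b → a + (2 + b) ≡ 2 + (a + b)
    swap = solve-∀

  avoiding : (v : Fin (suc n)) (l : List (Fin (suc n))) → All (v ≢_) l → ∃[ l′ ] map (punchIn v) l′ ≡ l
  avoiding v []      []         = [] , refl
  avoiding v (x ∷ l) (v≢x ∷ v∉) =
    let l′ , eq = avoiding v l v∉ in punchOut v≢x ∷ l′ , cong₂ _∷_ (punchIn-punchOut v≢x) eq

  unique-drop : ∀ {A : Set} {v : A} (xs : List A) {ys : List A} →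
    Unique (xs ++ v ∷ ys) → All (v ≢_) (xs ++ ys) × Unique (xs ++ ys)
  unique-drop []       (v∉ ∷ u) = v∉ , u
  unique-drop (x ∷ xs) (x∉ ∷ u) with All.++⁻ xs x∉ | unique-drop xs u
  ... | x∉xs , (x≢v ∷ x∉ys) | v∉ , u′ = ((x≢v ∘ sym) ∷ v∉) , (All.++⁺ x∉xs x∉ys ∷ u′)

  along-∖ : (G : Graph (suc n)) (v : Fin (suc n)) (l : List (Fin (suc n))) → Unique l →
    ∃[ l′ ] Unique l′ × along G l ≤ 2 + along (G ∖ v) l′
  along-∖ G v l u with v ∈? l
  along-∖ G v l u | no v∉l with avoiding v l (All.¬Any⇒All¬ l v∉l)
  ... | l′ , refl = l′ , Unique.map⁻ u , ≤-trans (≤-reflexive (along-punchIn G v l′)) (m≤n+m _ 2)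
  along-∖ G v l u | yes v∈l with ∈-∃++ v∈l
  ... | xs , ys , refl with unique-drop xs u
  ...   | v∉ , u′ with avoiding v (xs ++ ys) v∉
  ...     | l′ , eq = l′ , Unique.map⁻ (subst Unique (sym eq) u′) ,
    ≤-trans (along-insert G v xs ys)
      (≤-reflexive (cong (2 +_) (trans (cong (along G) (sym eq)) (along-punchIn G v l′))))

  oneEdgeAdj-unique : {u v x y : Fin n} → oneEdgeAdj u v → oneEdgeAdj x y → u ≡ x ⊎ u ≡ y
  oneEdgeAdj-unique {u = zero}     {suc zero} {zero}     {suc zero} _ _ = inj₁ refl
  oneEdgeAdj-unique {u = zero}     {suc zero} {suc zero} {zero}     _ _ = inj₂ refl
  oneEdgeAdj-unique {u = suc zero} {zero}     {zero}     {suc zero} _ _ = inj₂ refl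
  oneEdgeAdj-unique {u = suc zero} {zero}     {suc zero} {zero}     _ _ = inj₁ refl

  along-edgeless : (l : List (Fin n)) → along edgeless l ≡ 0
  along-edgeless []          = refl
  along-edgeless (x ∷ [])    = refl
  along-edgeless (x ∷ y ∷ l) = along-edgeless (y ∷ l)

  module _ {n : ℕ} where

    along-avoiding : {x y : Fin n} → oneEdgeAdj x y → (l : List (Fin n)) → All (x ≢_) l → along singleEdge l ≡ 0
    along-avoiding x~y []          _                  = refl
    along-avoiding x~y (u ∷ [])    _                  = refl
    along-avoiding x~y (u ∷ v ∷ l) (x≢u ∷ x≢v ∷ x∉l) =
      cong₂ _+_ (⟦⟧-no (oneEdgeAdj? u v) λ u~v → [ x≢u , x≢v ] (oneEdgeAdj-unique x~y u~v))
        (along-avoiding x~y (v ∷ l) (x≢v ∷ x∉l))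

    -- Once the edge has been passed from `x` to `y`, the rest of the list avoids `x`, and every
    -- adjacent pair contains `x`.
    along-singleEdge : (l : List (Fin n)) → Unique l → along singleEdge l ≤ 1
    along-singleEdge []          _          = z≤n
    along-singleEdge (x ∷ [])    _          = z≤n
    along-singleEdge (x ∷ y ∷ l) (x∉ ∷ u) with oneEdgeAdj? x y
    ... | no  _   = along-singleEdge (y ∷ l) u
    ... | yes x~y = s≤s (≤-reflexive (along-avoiding x~y (y ∷ l) x∉))

  -- Cutting an apex out of the list costs at most two edges; after `h` cuts only the seed is left.
  -- The bound is one below the number of edges that a balanced copy needs.
  along-splitGraph : ∀ c h n → c ≤ 1 → (l : List (Fin (h + n))) → Unique l →
    along (splitGraph c h n) l ≤ 2 * h + c
  along-splitGraph zero          zero n _ l u = ≤-reflexive (along-edgeless l)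
  along-splitGraph (suc zero)    zero n _ l u = along-singleEdge l u
  along-splitGraph (suc (suc _)) zero n (s≤s ()) l u
  along-splitGraph c (suc h) n c≤1 l u with along-∖ (splitGraph c (suc h) n) zero l u
  ... | l′ , u′ , ≤2+ = ≤-trans ≤2+ (≤-trans (+-monoʳ-≤ 2 (along-splitGraph c h n c≤1 l′ u′))
    (≤-reflexive (cong (_+ c) (sym (*-suc 2 h)))))

  insert-self : (i j : Fin (suc n)) (π : Permutation n n) → insert i j π ⟨$⟩ʳ i ≡ j
  insert-self i j π with i ≟ i
  ... | yes _   = refl
  ... | no  i≢i = contradiction refl i≢i

  punchIn-view : (v u : Fin (suc n)) → v ≡ u ⊎ ∃[ u′ ] punchIn v u′ ≡ u
  punchIn-view v u with v ≟ u
  ... | yes v≡u = inj₁ v≡u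
  ... | no  v≢u = inj₂ (punchOut v≢u , punchIn-punchOut v≢u)

  -- The given bijection is extended by sending `v` to the apex; all adjacencies at `v` match
  -- because `v` dominates.
  ≅-cone : (G : Graph (suc n)) (v : Fin (suc n)) {H : Graph n} →
    (∀ u → G ⊢ v ~ punchIn v u) → G ∖ v ≅ H → G ≅ cone H
  ≅-cone G v {H} dom i = record { bij = ρ ; preserve = preserve }
    where
    ρ = insert v zero (_≅_.bij i)
    preserve : ∀ u w → G ⊢ u ~ w ⇔ cone H ⊢ ρ ⟨$⟩ʳ u ~ ρ ⟨$⟩ʳ w
    preserve u w with punchIn-view v u | punchIn-view v w
    ... | inj₁ refl | inj₁ refl rewrite insert-self v zero (_≅_.bij i) =
      mk⇔ (Graph.~-irref G) λ ()
    ... | inj₁ refl | inj₂ (w′ , refl)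
      rewrite insert-self v zero (_≅_.bij i) | insert-punchIn v zero (_≅_.bij i) w′ =
      mk⇔ (λ _ → tt) (λ _ → dom w′)
    ... | inj₂ (u′ , refl) | inj₁ refl
      rewrite insert-self v zero (_≅_.bij i) | insert-punchIn v zero (_≅_.bij i) u′ =
      mk⇔ (λ _ → tt) (λ _ → Graph.~-sym G (dom u′))
    ... | inj₂ (u′ , refl) | inj₂ (w′ , refl)
      rewrite insert-punchIn v zero (_≅_.bij i) u′ | insert-punchIn v zero (_≅_.bij i) w′ =
      _≅_.preserve i u′ w′

-- The Turán problem for linear forests, with uniqueness.

module Turan where

  open Counting
  open Forests
  open SplitGraphs
  open import Data.Fin using (Fin; zero; suc; punchIn; punchOut)
  open import Data.Fin.Permutation using (_⟨$⟩ʳ_; insert; insert-punchIn; inverseˡ)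
  open import Data.Fin.Properties using (_≟_; any?; punchIn-punchOut)
  open import Data.List using ([]; _∷_)
  open import Data.List.Relation.Unary.All using ([]; _∷_)
  open import Data.List.Relation.Unary.AllPairs using ([]; _∷_)
  open import Data.Nat using (zero; suc; _+_; _*_; _≤_; _<_; z≤n; s≤s; s≤s⁻¹; _≤?_)
  open import Data.Nat.Properties hiding (_≟_; _≤?_)
  open import Data.Nat.Tactic.RingSolver using (solve-∀)
  open import Data.Product using (_×_; ∃-syntax; _,_)
  open import Data.Sum using (_⊎_; inj₁; inj₂)
  open import Data.Unit using (tt)
  open import Function using (_∘_; _⇔_; mk⇔; Inverse)
  open import Function.Construct.Composition using (_⇔-∘_)
  open import Function.Construct.Identity using (↔-id)
  open import Function.Construct.Symmetry using (⇔-sym)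
  open import Relation.Binary.PropositionalEquality
  open import Relation.Nullary using (yes; no; ¬_; contradiction)
  open import Relation.Unary using (Pred; Decidable)
  open import Level using (0ℓ)

  cherry : (G : Graph n) {x y z : Fin n} → G ⊢ x ~ y → G ⊢ y ~ z → x ≢ z → Forest 2 G
  cherry G {x} {y} {z} x~y y~z x≢z = x ∷ y ∷ z ∷ [] ,
    ((≢-of x~y ∷ x≢z ∷ []) ∷ (≢-of y~z ∷ []) ∷ [] ∷ []) , s≤s (s≤s (s≤s z≤n)) ,
    ≤-reflexive (sym (trans (edge⇒along G (z ∷ []) x~y) (cong suc (edge⇒along G [] y~z))))
    where
    ≢-of : ∀ {u v} → G ⊢ u ~ v → u ≢ v
    ≢-of u~u refl = Graph.~-irref G u~u

  -- Two distinct edges either share one endpoint and form a cherry, or are disjoint and form a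
  -- matching; both are forests with two edges.
  onlyEdge : (G : Graph n) → ¬ Forest 2 G → ∀ {a b u v} → G ⊢ a ~ b → G ⊢ u ~ v →
    (u ≡ a × v ≡ b) ⊎ (u ≡ b × v ≡ a)
  onlyEdge G none {a} {b} {u} {v} a~b u~v with u ≟ a | v ≟ b | u ≟ b | v ≟ a
  ... | yes u≡a  | yes v≡b | _       | _       = inj₁ (u≡a , v≡b)
  ... | _        | _       | yes u≡b | yes v≡a = inj₂ (u≡b , v≡a)
  ... | yes refl | no v≢b  | _       | _       = contradiction (cherry G (Graph.~-sym G u~v) a~b v≢b) none
  ... | no u≢a   | yes refl | _      | _       = contradiction (cherry G u~v (Graph.~-sym G a~b) u≢a) none
  ... | _        | _       | yes refl | no v≢a = contradiction (cherry G (Graph.~-sym G u~v) (Graph.~-sym G a~b) v≢a) none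
  ... | _        | _       | no u≢b  | yes refl = contradiction (cherry G u~v a~b u≢b) none
  ... | no u≢a   | no v≢b  | no u≢b  | no v≢a  = contradiction disjointPair none
    where
    disjointPair : Forest 2 G
    disjointPair = a ∷ b ∷ u ∷ v ∷ [] ,
      (((λ { refl → Graph.~-irref G a~b }) ∷ (u≢a ∘ sym) ∷ (v≢a ∘ sym) ∷ []) ∷ ((u≢b ∘ sym) ∷ (v≢b ∘ sym) ∷ []) ∷
        ((λ { refl → Graph.~-irref G u~v }) ∷ []) ∷ [] ∷ []) , ≤-refl ,
      ≤-trans (s≤s (≤-trans (≤-reflexive (sym (edge⇒along G [] u~v))) (along≤along-∷ G b (u ∷ v ∷ []))))
        (≤-reflexive (sym (edge⇒along G (u ∷ v ∷ []) a~b)))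

  singleEdge-⇔ : {u v : Fin (suc (suc n))} → oneEdgeAdj u v ⇔ ((u ≡ zero × v ≡ suc zero) ⊎ (u ≡ suc zero × v ≡ zero))
  singleEdge-⇔ {u = u} {v} = mk⇔ (to u v) from
    where
    to : ∀ u v → oneEdgeAdj u v → (u ≡ zero × v ≡ suc zero) ⊎ (u ≡ suc zero × v ≡ zero)
    to zero       (suc zero) _ = inj₁ (refl , refl)
    to (suc zero) zero       _ = inj₂ (refl , refl)
    from : ∀ {u v} → (u ≡ zero × v ≡ suc zero) ⊎ (u ≡ suc zero × v ≡ zero) → oneEdgeAdj u v
    from (inj₁ (refl , refl)) = tt
    from (inj₂ (refl , refl)) = tt

  -- The inner insertion sends `b`, renumbered without `a`, to `zero`; inserting `a` at `zero` then
  -- pushes that image up to `suc zero`.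
  movingPair : (a b : Fin (suc (suc n))) → a ≢ b →
    ∃[ π ] (π ⟨$⟩ʳ a ≡ zero) × (_⟨$⟩ʳ_ {n = suc (suc n)} π b ≡ suc zero)
  movingPair a b a≢b = π , insert-self a zero ρ ,
    trans (cong (π ⟨$⟩ʳ_) (sym (punchIn-punchOut a≢b)))
      (trans (insert-punchIn a zero ρ b′) (cong suc (insert-self b′ zero (↔-id _))))
    where
    b′ = punchOut a≢b
    ρ = insert b′ zero (↔-id _)
    π = insert a zero ρ

  ≅-singleEdge : (G : Graph n) → ¬ Forest 2 G → 2 ≤ degreeSum G → G ≅ singleEdge
  ≅-singleEdge G none 2≤∑ with findEdge G (≤-trans (n≤1+n 1) 2≤∑)
  ≅-singleEdge {suc zero}    G none 2≤∑ | zero , zero , a~a = contradiction a~a (Graph.~-irref G)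
  ≅-singleEdge {suc (suc n)} G none 2≤∑ | a , b , a~b with movingPair a b (λ { refl → Graph.~-irref G a~b })
  ... | π , πa≡0 , πb≡1 = record { bij = π ; preserve = λ u v → ⇔-sym singleEdge-⇔ ⇔-∘ mk⇔ (to u v) from }
    where
    to : ∀ u v → G ⊢ u ~ v →
      (π ⟨$⟩ʳ u ≡ zero × π ⟨$⟩ʳ v ≡ suc zero) ⊎ (π ⟨$⟩ʳ u ≡ suc zero × π ⟨$⟩ʳ v ≡ zero)
    to u v u~v with onlyEdge G none a~b u~v
    ... | inj₁ (refl , refl) = inj₁ (πa≡0 , πb≡1)
    ... | inj₂ (refl , refl) = inj₂ (πb≡1 , πa≡0)
    injective : ∀ {u x y} → π ⟨$⟩ʳ x ≡ y → π ⟨$⟩ʳ u ≡ y → u ≡ x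
    injective p q = trans (sym (inverseˡ π)) (trans (cong (Inverse.from π) (trans q (sym p))) (inverseˡ π))
    from : ∀ {u v} → (π ⟨$⟩ʳ u ≡ zero × π ⟨$⟩ʳ v ≡ suc zero) ⊎ (π ⟨$⟩ʳ u ≡ suc zero × π ⟨$⟩ʳ v ≡ zero) → G ⊢ u ~ v
    from (inj₁ (p , q)) rewrite injective πa≡0 p | injective πb≡1 q = a~b
    from (inj₂ (p , q)) rewrite injective πb≡1 p | injective πa≡0 q = Graph.~-sym G a~b

  sum-full : {R : Pred (Fin n) 0ℓ} (R? : Decidable R) → n ≤ ∑[ x < n ] ⟦ R? x ⟧ → ∀ x → R x
  sum-full {suc n} R? n≤∑ x with R? x in eq
  ... | yes r = r
  ... | no ¬r = contradiction n≤∑ (<⇒≱ (s≤s (begin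
    ∑[ y < suc n ] ⟦ R? y ⟧                      ≡⟨ sum-remove {i = x} (λ y → ⟦ R? y ⟧) ⟩
    ⟦ R? x ⟧ + ∑[ y < n ] ⟦ R? (punchIn x y) ⟧   ≡⟨ cong (_+ ∑[ y < n ] ⟦ R? (punchIn x y) ⟧) (⟦⟧-no (R? x) ¬r) ⟩
    ∑[ y < n ] ⟦ R? (punchIn x y) ⟧              ≤⟨ sum-mono (λ y → ⟦⟧≤1 (R? (punchIn x y))) ⟩
    ∑[ y < n ] 1                                 ≡⟨ sum-ones n ⟩
    n                                            ∎)))
    where open ≤-Reasoning

  degree≤ : (G : Graph (suc n)) (v : Fin (suc n)) → degree G v ≤ n
  degree≤ {n} G v = ≤-trans (≤-reflexive (degree-punchIn G v))
    (≤-trans (sum-mono (λ u → ⟦⟧≤1 (G ⊢ v ~? punchIn v u))) (≤-reflexive (sum-ones n)))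

  manyEdges : ∀ c → c ≤ 1 → (G : Graph n) → 2 * suc c ≤ degreeSum G → Forest (suc c) G
  manyEdges zero          _        = oneEdge
  manyEdges (suc zero)    _        = twoEdges
  manyEdges (suc (suc c)) (s≤s ())

  ≅-seed : ∀ c → c ≤ 1 → (G : Graph n) → 2 * c ≤ degreeSum G → ¬ Forest (suc c) G → G ≅ seed c n
  ≅-seed zero _ G _ none = record { bij = ↔-id _ ; preserve = λ u v → mk⇔ (edge u v) λ () }
    where
    edge : ∀ u v → ¬ G ⊢ u ~ v
    edge u v u~v = none (u ∷ v ∷ [] , ((λ { refl → Graph.~-irref G u~v }) ∷ []) ∷ [] ∷ [] , ≤-refl ,
      ≤-reflexive (sym (edge⇒along G [] u~v)))
  ≅-seed (suc zero) _ G 2≤∑ none = ≅-singleEdge G none 2≤∑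
  ≅-seed (suc (suc c)) (s≤s ())

  -- Only a lower bound on the number of edges is assumed; equality comes out at the end. The
  -- largeness condition survives the deletion of a vertex, which lowers its left side by 33 and its
  -- right side by 2.
  extremal-≅ : ∀ c h n → c ≤ 1 → 2 * c ≤ n → 33 * h + 16 * c ≤ 2 * (h + n) + 9 →
    (G : Graph (h + n)) → 2 * (h * (h + n)) + 2 * c ≤ degreeSum G + h * suc h →
    ¬ Forest (2 * h + suc c) G → G ≅ splitGraph c h n
  extremal-≅ c zero    n c≤1 2c≤n large G size none =
    ≅-seed c c≤1 G (subst (2 * c ≤_) (+-identityʳ _) size) none
  extremal-≅ c (suc h) n c≤1 2c≤n large G size none with any? (λ v → 2 * (2 * h + suc c) + 2 ≤? degree G v)
  ... | yes (v , big) = ≅-cone G v dominating IH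
    where
    N = h + n
    none′ : ¬ Forest (2 * h + suc c) (G ∖ v)
    none′ forest = none (subst (λ m → Forest m G) (cong (_+ suc c) (sym (*-suc 2 h)))
      (extendByCherry G v big forest))
    size∖ : 2 * (suc h * suc N) + 2 * c ≤ 2 * degree G v + degreeSum (G ∖ v) + suc h * suc (suc h)
    size∖ = subst (λ s → 2 * (suc h * suc N) + 2 * c ≤ s + suc h * suc (suc h)) (degreeSum-∖ G v) size
    size′ : 2 * (h * N) + 2 * c ≤ degreeSum (G ∖ v) + h * suc h
    size′ = ≤-from 0 (+-mono-≤ size∖ (*-monoʳ-≤ 2 (degree≤ G v)))
      (arith h N c (degree G v) (degreeSum (G ∖ v)))
      where
      arith : ∀ h N c d s → 2 * (h * N) + 2 * c + (2 * d + s + suc h * suc (suc h) + 2 * N) + 0 ≡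
        s + h * suc h + (2 * (suc h * suc N) + 2 * c + 2 * d)
      arith = solve-∀
    large′ : 33 * h + 16 * c ≤ 2 * N + 9
    large′ = ≤-from 31 large (arith h N c)
      where
      arith : ∀ h N c → 33 * h + 16 * c + (2 * suc N + 9) + 31 ≡ 2 * N + 9 + (33 * suc h + 16 * c)
      arith = solve-∀
    IH : G ∖ v ≅ splitGraph c h n
    IH = extremal-≅ c h n c≤1 2c≤n large′ (G ∖ v) size′ none′
    -- By the induction hypothesis the number of edges left after deleting `v` is known exactly, so
    -- `v` must carry all the others that `size` demands, and it is adjacent to every vertex.
    full : N ≤ degree G v
    full = *-cancelˡ-≤ 2 (≤-from 0
      (+-mono-≤ size∖
        (≤-reflexive (trans (cong (_+ h * suc h) (degreeSum-≅ IH)) (degreeSum-splitGraph c h n c≤1 2c≤n))))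
      (arith h N c (degree G v) (degreeSum (G ∖ v))))
      where
      arith : ∀ h N c d s → 2 * N + (2 * d + s + suc h * suc (suc h) + (2 * (h * N) + 2 * c)) + 0 ≡
        2 * d + (2 * (suc h * suc N) + 2 * c + (s + h * suc h))
      arith = solve-∀
    dominating : ∀ u → G ⊢ v ~ punchIn v u
    dominating = sum-full (λ u → G ⊢ v ~? punchIn v u) (subst (N ≤_) (degree-punchIn G v) full)
  ... | no small = contradiction
    (peelEdges (suc c) (s≤s z≤n) (manyEdges c c≤1) (2 * (2 * h + suc c)) (2 * suc h) G degrees≤ enough) none
    where
    degrees≤ : ∀ v → degree G v ≤ suc (2 * (2 * h + suc c))
    degrees≤ v = s≤s⁻¹ (≤-trans (≰⇒> (λ big → small (v , big))) (≤-reflexive (+-comm _ 2)))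
    -- Put H = h + 1, with N vertices in all. Degrees are at most 2m - 3 = 4H - 1 + 2c, so each of
    -- 2H removals loses at most 8H - 3 + 4c edges, and c + 1 edges must remain, while HN - H(H +
    -- 1)/2 + c are available. Doubling and dividing by H turns this into 33H + 16c ≤ 2N + 11 - 2/H;
    -- the constant 9 is the worst case H = 1.
    enough : 2 * (2 * suc h * suc (2 * (2 * (2 * h + suc c))) + suc c) ≤ degreeSum G
    enough = ≤-from (2 * h) (+-mono-≤ size (*-monoʳ-≤ (suc h) large)) (arith h (h + n) c (degreeSum G))
      where
      arith : ∀ h N c s →
        2 * (2 * suc h * suc (2 * (2 * (2 * h + suc c))) + suc c) +
          (s + suc h * suc (suc h) + suc h * (2 * suc N + 9)) + 2 * h ≡
        s + (2 * (suc h * suc N) + 2 * c + suc h * (33 * suc h + 16 * c))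
      arith = solve-∀

-- Sliding a path through the complete graph.

module Sliding where

  open Counting
  open Forests
  open SplitGraphs using (unique-drop)
  open import Data.Fin using (Fin)
  open import Data.Fin.Properties using (_≟_)
  open import Data.List using (List; []; _∷_; _++_; _∷ʳ_; length; take; allFin)
  open import Data.List.Membership.Propositional using (_∉_)
  open import Data.List.Membership.Propositional.Properties using (∈-∃++; ∈-++⁺ˡ; ∈-++⁺ʳ; ∈-++⁻)
  open import Data.List.Properties using (++-assoc; ++-identityʳ; ∷ʳ-++; length-take; length-tabulate)
  open import Data.List.Relation.Binary.Permutation.Propositional using (_↭_; ↭-sym; ↭⇒↭ₛ)
  open import Data.List.Relation.Binary.Permutation.Propositional.Properties using (shift; ++-comm; ↭-length)
  import Data.List.Relation.Binary.Permutation.Setoid.Properties as PermutationSetoid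
  open import Data.List.Relation.Unary.All using (All; []; _∷_)
  import Data.List.Relation.Unary.All as All
  import Data.List.Relation.Unary.All.Properties as All
  open import Data.List.Relation.Unary.AllPairs using ([]; _∷_)
  open import Data.List.Relation.Unary.Any using (here; there)
  open import Data.List.Relation.Unary.Unique.Propositional using (Unique)
  import Data.List.Relation.Unary.Unique.Propositional.Properties as Unique
  open import Data.Nat using (ℕ; zero; suc; _+_; _*_; _∸_; _⊓_; _≤_; _<_; z≤n; s≤s; s≤s⁻¹)
  open import Data.Nat.Properties hiding (_≟_)
  open import Data.Nat.Tactic.RingSolver using (solve-∀)
  open import Data.Product using (_×_; ∃-syntax; _,_; proj₁; proj₂)
  open import Data.Sum using (_⊎_; inj₁; inj₂; [_,_])
  open import Function using (_∘_; id)
  open import Relation.Binary using (tri<; tri≈; tri>)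
  open import Relation.Binary.PropositionalEquality hiding ([_])
  open import Relation.Nullary using (yes; no; ¬_; contradiction)

  unique-↭ : {A : Set} {xs ys : List A} → xs ↭ ys → Unique xs → Unique ys
  unique-↭ {A} p = PermutationSetoid.Unique-resp-↭ (setoid A) (↭⇒↭ₛ p)

  unique-∷ : {A : Set} {x : A} {l : List A} → x ∉ l → Unique l → Unique (x ∷ l)
  unique-∷ {l = l} x∉l u = All.¬Any⇒All¬ l x∉l ∷ u

  unique-∉ : {A : Set} {x : A} (xs : List A) {ys : List A} → Unique (xs ++ x ∷ ys) → x ∉ xs ++ ys
  unique-∉ xs u = All.All¬⇒¬Any (proj₁ (unique-drop xs u))

  ∉-insert : {A : Set} {x y : A} (xs : List A) {ys : List A} → y ≢ x → y ∉ xs ++ ys → y ∉ xs ++ x ∷ ys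
  ∉-insert xs y≢x y∉ y∈ with ∈-++⁻ xs y∈
  ... | inj₁ y∈xs         = y∉ (∈-++⁺ˡ y∈xs)
  ... | inj₂ (here y≡x)   = y≢x y≡x
  ... | inj₂ (there y∈ys) = y∉ (∈-++⁺ʳ xs y∈ys)

  ∉-drop : {A : Set} {x y : A} (xs : List A) {ys : List A} → y ∉ xs ++ x ∷ ys → y ∉ xs ++ ys
  ∉-drop xs y∉ y∈ = [ y∉ ∘ ∈-++⁺ˡ , y∉ ∘ ∈-++⁺ʳ xs ∘ there ] (∈-++⁻ xs y∈)

  unique-replace : {A : Set} {x y : A} (xs : List A) {ys : List A} →
    Unique (xs ++ x ∷ ys) → y ∉ xs ++ ys → Unique (xs ++ y ∷ ys)
  unique-replace {y = y} xs {ys} u y∉ =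
    unique-↭ (↭-sym (shift y xs ys)) (unique-∷ y∉ (proj₂ (unique-drop xs u)))

  length-replace : {A : Set} {x y : A} (xs : List A) {ys : List A} →
    length (xs ++ y ∷ ys) ≡ length (xs ++ x ∷ ys)
  length-replace []       = refl
  length-replace (_ ∷ xs) = cong suc (length-replace xs)

  along-∷≤ : (G : Graph n) (x : Fin n) (l : List (Fin n)) → along G (x ∷ l) ≤ suc (along G l)
  along-∷≤ G x []      = z≤n
  along-∷≤ G x (y ∷ l) = +-monoˡ-≤ _ (⟦⟧≤1 (G ⊢ x ~? y))

  along≤along-∷ʳ : (G : Graph n) (l : List (Fin n)) (x : Fin n) → along G l ≤ along G (l ∷ʳ x)
  along≤along-∷ʳ G []          x = z≤n
  along≤along-∷ʳ G (y ∷ [])    x = z≤n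
  along≤along-∷ʳ G (y ∷ z ∷ l) x = +-monoʳ-≤ ⟦ G ⊢ y ~? z ⟧ (along≤along-∷ʳ G (z ∷ l) x)

  module _ (G : Graph n) (m K : ℕ) (K<n : K < n)
    (avoided : ∀ l → Unique l → length l ≡ K → along G l ≢ m) where

    Heavy : List (Fin n) → Set
    Heavy l = m < along G l

    -- Dropping `x` loses at most one edge and appending `y` loses none, so at least `m` edges
    -- remain; exactly `m` is excluded by `avoided`.
    slide : ∀ x l y → length (l ∷ʳ y) ≡ K → Unique (l ∷ʳ y) → Heavy (x ∷ l) → Heavy (l ∷ʳ y)
    slide x l y len u heavy = ≤∧≢⇒<
      (≤-trans (s≤s⁻¹ (≤-trans heavy (along-∷≤ G x l))) (along≤along-∷ʳ G l y))
      (avoided (l ∷ʳ y) u len ∘ sym)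

    -- The vertex dropped in front is the one appended at the end, so no outside vertex is required.
    rotate : ∀ xs ys → length (xs ++ ys) ≡ K → Unique (xs ++ ys) → Heavy (xs ++ ys) → Heavy (ys ++ xs)
    rotate []       ys len u heavy = subst Heavy (sym (++-identityʳ ys)) heavy
    rotate (x ∷ xs) ys len u heavy =
      subst Heavy (∷ʳ-++ ys x xs)
        (rotate xs (ys ∷ʳ x) (subst (λ l → length l ≡ K) assoc len′) (subst Unique assoc u′)
          (subst Heavy assoc (slide x (xs ++ ys) x len′ u′ heavy)))
      where
      assoc : (xs ++ ys) ∷ʳ x ≡ xs ++ (ys ∷ʳ x)
      assoc = ++-assoc xs ys (x ∷ [])
      turn : x ∷ xs ++ ys ↭ (xs ++ ys) ∷ʳ x
      turn = ++-comm (x ∷ []) (xs ++ ys)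
      len′ = trans (sym (↭-length turn)) len
      u′ = unique-↭ turn u

    -- `x` is rotated to the front, slid off while `y` enters at the end, and a last rotation brings
    -- `y` to the old place of `x`.
    replace : ∀ xs x ys y → length (xs ++ x ∷ ys) ≡ K → Unique (xs ++ x ∷ ys) → y ∉ xs ++ ys →
      Heavy (xs ++ x ∷ ys) → Heavy (xs ++ y ∷ ys)
    replace xs x ys y len u y∉ heavy =
      subst Heavy (∷ʳ-++ xs y ys)
        (rotate ys (xs ∷ʳ y) (subst (λ l → length l ≡ K) assoc len′) (subst Unique assoc u′)
          (subst Heavy assoc (slide x (ys ++ xs) y len′ u′ (rotate xs (x ∷ ys) len u heavy))))
      where
      assoc : (ys ++ xs) ∷ʳ y ≡ ys ++ (xs ∷ʳ y)
      assoc = ++-assoc ys xs (y ∷ [])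
      turn : xs ++ y ∷ ys ↭ (ys ++ xs) ∷ʳ y
      turn = subst (xs ++ y ∷ ys ↭_) (sym assoc) (subst (_↭ ys ++ (xs ∷ʳ y)) (∷ʳ-++ xs y ys) (++-comm (xs ∷ʳ y) ys))
      len′ = trans (sym (↭-length turn)) (trans (length-replace xs) len)
      u′ = unique-↭ turn (unique-replace xs u y∉)

    mutual

      -- p is the part of the list that already agrees with the target p ++ t.
      transform : ∀ p l t → length l ≡ length t → length (p ++ l) ≡ K → Unique (p ++ l) → Unique (p ++ t) →
        Heavy (p ++ l) → Heavy (p ++ t)
      transform p []      []      eq len u u′ heavy = heavy
      transform p (a ∷ l) (b ∷ t) eq len u u′ heavy with a ≟ b | b ∈? l
      ... | yes refl | _      = advance p a l t (suc-injective eq) len u u′ heavy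
      ... | no a≢b   | no b∉l =
        advance p b l t (suc-injective eq) (trans (length-replace p) len) (unique-replace p u b∉) u′
          (replace p a l b len u b∉ heavy)
        where
        b∉ : b ∉ p ++ l
        b∉ = [ unique-∉ p u′ ∘ ∈-++⁺ˡ , b∉l ] ∘ ∈-++⁻ p
      -- `b` already stands further back and cannot enter a second time, so a vertex `z` outside the
      -- list first takes its place there. Such a `z` exists because of `K<n`; this is where sliding
      -- needs a spare vertex.
      ... | no a≢b   | yes b∈l with ∈-∃++ b∈l
      ...   | v , w , refl =
        advance p b (v ++ z ∷ w) t
          (trans (length-replace v) (suc-injective eq)) (trans (length-replace p) len₂)
          (unique-replace p u₂ b∉₂) u′ (replace p a (v ++ z ∷ w) b len₂ u₂ b∉₂ heavy₂)
        where
        front : ∀ x → (p ++ a ∷ v) ++ x ∷ w ≡ p ++ a ∷ (v ++ x ∷ w)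
        front x = ++-assoc p (a ∷ v) (x ∷ w)
        pick = freshVertex (p ++ a ∷ (v ++ b ∷ w)) (≤-trans (s≤s (≤-reflexive len)) K<n)
        z = proj₁ pick
        z∉ : z ∉ (p ++ a ∷ v) ++ b ∷ w
        z∉ = subst (z ∉_) (sym (front b)) (proj₂ pick)
        len₁ = subst (λ l → length l ≡ K) (sym (front b)) len
        u₁ = subst Unique (sym (front b)) u
        z∉₁ = ∉-drop (p ++ a ∷ v) z∉
        len₂ = subst (λ l → length l ≡ K) (front z) (trans (length-replace (p ++ a ∷ v)) len₁)
        u₂ = subst Unique (front z) (unique-replace (p ++ a ∷ v) u₁ z∉₁)
        heavy₂ = subst Heavy (front z)
          (replace (p ++ a ∷ v) b w z len₁ u₁ z∉₁ (subst Heavy (sym (front b)) heavy))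
        b≢z : b ≢ z
        b≢z b≡z = z∉ (∈-++⁺ʳ (p ++ a ∷ v) (here (sym b≡z)))
        b∉₂ : b ∉ p ++ v ++ z ∷ w
        b∉₂ = ∉-drop p (subst (b ∉_) (front z) (∉-insert (p ++ a ∷ v) b≢z (unique-∉ (p ++ a ∷ v) u₁)))

      advance : ∀ p b l t → length l ≡ length t → length (p ++ b ∷ l) ≡ K →
        Unique (p ++ b ∷ l) → Unique (p ++ b ∷ t) → Heavy (p ++ b ∷ l) → Heavy (p ++ b ∷ t)
      advance p b l t eq len u u′ heavy = subst Heavy (∷ʳ-++ p b t)
        (transform (p ∷ʳ b) l t eq (subst (λ l → length l ≡ K) (sym (∷ʳ-++ p b l)) len)
          (subst Unique (sym (∷ʳ-++ p b l)) u) (subst Unique (sym (∷ʳ-++ p b t)) u′)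
          (subst Heavy (sym (∷ʳ-++ p b l)) heavy))

    arc : List (Fin n)
    arc = take K (allFin n)

    arc-unique : Unique arc
    arc-unique = Unique.take⁺ K (Unique.allFin⁺ n)

    arc-length : length arc ≡ K
    arc-length = trans (length-take K (allFin n))
      (trans (cong (K ⊓_) (length-tabulate {n = n} id)) (m≤n⇒m⊓n≡m (<⇒≤ K<n)))

    -- One reference list suffices: heaviness travels from any list to any other, so a heavy list
    -- would make a light `arc` heavy, and a heavy `arc` makes every list heavy.
    allLightOrAllHeavy : (∀ l → Unique l → length l ≡ K → along G l < m) ⊎
                         (∀ l → Unique l → length l ≡ K → m < along G l)
    allLightOrAllHeavy with <-cmp (along G arc) m
    ... | tri< light _ _ = inj₁ λ l u len → ≤∧≢⇒< (≮⇒≥ λ heavy →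
      <-asym light (transform [] l arc (trans len (sym arc-length)) len u arc-unique heavy)) (avoided l u len)
    ... | tri≈ _ eq _    = contradiction eq (avoided arc arc-unique arc-length)
    ... | tri> _ _ heavy = inj₂ λ l u len →
      transform [] arc l (trans arc-length (sym len)) arc-length arc-unique u heavy

  padTo : (G : Graph n) (j : ℕ) (l : List (Fin n)) → Unique l → j + length l ≤ n →
    ∃[ l′ ] Unique l′ × length l′ ≡ j + length l × along G l ≤ along G l′
  padTo G zero    l u _   = l , u , refl , ≤-refl
  padTo G (suc j) l u len =
    let l′ , u′ , len′ , ≤′ = padTo G j l u (≤-trans (n≤1+n _) len)
        x , x∉ = freshVertex l′ (subst (_< _) (sym len′) len)
    in x ∷ l′ , unique-∷ x∉ u′ , cong suc len′ , ≤-trans ≤′ (along≤along-∷ G x l′)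

  light⇒¬Forest : (G : Graph n) (m : ℕ) → suc (2 * m) ≤ n →
    (∀ l → Unique l → length l ≡ suc (2 * m) → along G l < m) → ¬ Forest m G
  light⇒¬Forest G m 2m<n light (l , u , len , m≤) =
    let l′ , u′ , len′ , ≤′ = padTo G (suc (2 * m) ∸ length l) l u (≤-trans (≤-reflexive fits) 2m<n)
    in <⇒≱ (light l′ u′ (trans len′ fits)) (≤-trans m≤ ≤′)
    where
    fits : suc (2 * m) ∸ length l + length l ≡ suc (2 * m)
    fits = m∸n+n≡m (≤-trans len (n≤1+n _))

  module _ (C : Colouring n) where

    colours : ∀ {x y} → x ≢ y → ⟦ R C ⊢ x ~? y ⟧ + ⟦ B C ⊢ x ~? y ⟧ ≡ 1
    colours {x} {y} x≢y with R C ⊢ x ~? y | B C ⊢ x ~? y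
    ... | yes r | yes b = contradiction (r , b) (Colouring.disjoint C)
    ... | yes _ | no  _ = refl
    ... | no  _ | yes _ = refl
    ... | no ¬r | no ¬b = contradiction (Colouring.cover C x≢y) [ ¬r , ¬b ]

    along-colours : ∀ x l → Unique (x ∷ l) → along (R C) (x ∷ l) + along (B C) (x ∷ l) ≡ length l
    along-colours x []      _                   = refl
    along-colours x (y ∷ l) ((x≢y ∷ _) ∷ u) = trans
      (interchange ⟦ R C ⊢ x ~? y ⟧ _ ⟦ B C ⊢ x ~? y ⟧ _)
      (cong₂ _+_ (colours x≢y) (along-colours y l u))
      where
      interchange : ∀ a b c d → (a + b) + (c + d) ≡ (a + c) + (b + d)
      interchange = solve-∀

-- Balanced copies of a path as vertex lists, and their decidability.

module Copies where

  open Counting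
  open Forests
  open import Data.Fin using (Fin; zero; suc; toℕ; inject₁; _<?_)
  open import Data.Fin.Properties using (_≟_; any?)
  open import Data.List using (List; []; _∷_; length; filter; tabulate; lookup; allFin; cartesianProduct)
  open import Data.List.Properties using (tabulate-lookup; length-tabulate)
  open import Data.List.Relation.Unary.All using (All; []; _∷_)
  import Data.List.Relation.Unary.All.Properties as All
  open import Data.List.Relation.Unary.AllPairs using ([]; _∷_)
  open import Data.List.Relation.Unary.Unique.DecPropositional using (unique?)
  open import Data.List.Relation.Unary.Unique.Propositional using (Unique)
  import Data.List.Relation.Unary.Unique.Propositional.Properties as Unique
  import Data.Nat as ℕ
  open import Data.Nat using (ℕ; zero; suc; _+_; _*_; _<_)
  open import Data.Nat.Properties hiding (_≟_; _<?_)
  open import Data.Product using (_×_; ∃-syntax; _,_)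
  open import Data.Sum using (inj₁; inj₂)
  open import Data.Unit using (tt)
  open import Function using (_∘_; id; mk⇔; Injective)
  open import Level using (0ℓ)
  open import Relation.Binary.PropositionalEquality
  open import Relation.Nullary using (Dec; yes; no; contradiction)
  open import Relation.Nullary.Decidable using (_×-dec_; map′)
  open import Relation.Unary using (Pred; Decidable)

  length-filter-filter : {A : Set} {P Q : Pred A 0ℓ} (P? : Decidable P) (Q? : Decidable Q) (l : List A) →
    length (filter P? (filter Q? l)) ≡ length (filter (λ x → Q? x ×-dec P? x) l)
  length-filter-filter P? Q? []      = refl
  length-filter-filter P? Q? (x ∷ l) with Q? x
  ... | no  _ = length-filter-filter P? Q? l
  ... | yes _ with P? x
  ...   | yes _ = cong suc (length-filter-filter P? Q? l)
  ...   | no  _ = length-filter-filter P? Q? l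

  ∑-consecutive : ∀ k {D : Fin (suc k) → Fin (suc k) → Set} (D? : ∀ u v → Dec (D u v)) →
    ∑[ u < suc k ] ∑[ v < suc k ] ⟦ (toℕ v ℕ.≟ suc (toℕ u)) ×-dec D? u v ⟧ ≡
    ∑[ i < k ] ⟦ D? (inject₁ i) (suc i) ⟧
  ∑-consecutive zero    D? = refl
  ∑-consecutive (suc k) D? = cong₂ _+_
    (trans (cong (⟦ D? zero (suc zero) ⟧ +_) (trans (sum-const k 0) (*-zeroʳ k))) (+-identityʳ _))
    (∑-consecutive k (λ u v → D? (suc u) (suc v)))

  path-step : ∀ {k} {D : Set} (D? : Dec D) (u v : Fin (suc k)) →
    ⟦ ((u <? v) ×-dec (path k ⊢ u ~? v)) ×-dec D? ⟧ ≡ ⟦ (toℕ v ℕ.≟ suc (toℕ u)) ×-dec D? ⟧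
  path-step {k} D? u v = ⟦⟧-cong (((u <? v) ×-dec (path k ⊢ u ~? v)) ×-dec D?) ((toℕ v ℕ.≟ suc (toℕ u)) ×-dec D?) (mk⇔
    (λ { ((u<v , inj₁ eq) , d) → eq , d
       ; ((u<v , inj₂ eq) , d) → contradiction u<v (<-asym (≤-reflexive (sym eq))) })
    (λ (eq , d) → (≤-reflexive (sym eq) , inj₁ eq) , d))

  -- The condition `u <? v` kills one orientation of each path edge, and the other pairs each
  -- position with the next. The edge count of a copy thus becomes `along` of its list of vertices.
  filter-path : ∀ {k} {D : Fin (suc k) → Fin (suc k) → Set} (D? : ∀ u v → Dec (D u v)) →
    length (filter (λ (u , v) → D? u v) (edges (path k))) ≡ ∑[ i < k ] ⟦ D? (inject₁ i) (suc i) ⟧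
  filter-path {k} D? = begin
    length (filter (λ (u , v) → D? u v) (edges (path k)))
      ≡⟨ length-filter-filter (λ (u , v) → D? u v) (λ (u , v) → (u <? v) ×-dec (path k ⊢ u ~? v))
         (cartesianProduct (allFin (suc k)) (allFin (suc k))) ⟩
    length (filter (λ (u , v) → ((u <? v) ×-dec (path k ⊢ u ~? v)) ×-dec D? u v)
                   (cartesianProduct (allFin (suc k)) (allFin (suc k))))
      ≡⟨ length-filter-product (λ (u , v) → ((u <? v) ×-dec (path k ⊢ u ~? v)) ×-dec D? u v) id id ⟩
    ∑[ u < suc k ] ∑[ v < suc k ] ⟦ ((u <? v) ×-dec (path k ⊢ u ~? v)) ×-dec D? u v ⟧
      ≡⟨ sum-cong-≗ (λ u → sum-cong-≗ (λ v → path-step (D? u v) u v)) ⟩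
    ∑[ u < suc k ] ∑[ v < suc k ] ⟦ (toℕ v ℕ.≟ suc (toℕ u)) ×-dec D? u v ⟧
      ≡⟨ ∑-consecutive k D? ⟩
    ∑[ i < k ] ⟦ D? (inject₁ i) (suc i) ⟧
      ∎
    where open ≡-Reasoning

  along-tabulate : ∀ {k} (G : Graph n) (φ : Fin (suc k) → Fin n) →
    along G (tabulate φ) ≡ ∑[ i < k ] ⟦ G ⊢ φ (inject₁ i) ~? φ (suc i) ⟧
  along-tabulate {k = zero}  G φ = refl
  along-tabulate {k = suc k} G φ = cong (⟦ G ⊢ φ zero ~? φ (suc zero) ⟧ +_) (along-tabulate G (φ ∘ suc))

  edgesInto-path : ∀ {k} (G : Graph n) (φ : Fin (suc k) → Fin n) →
    edgesInto (path k) φ G ≡ along G (tabulate φ)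
  edgesInto-path G φ = trans (filter-path (λ u v → G ⊢ φ u ~? φ v)) (sym (along-tabulate G φ))

  e-path : ∀ k → e (path k) ≡ k
  e-path k = trans (sym (length-filter-all (edges (path k))))
    (trans (filter-path {k} (λ _ _ → yes tt)) (sum-ones k))
    where
    length-filter-all : {A : Set} (l : List A) → length (filter (λ _ → yes tt) l) ≡ length l
    length-filter-all []      = refl
    length-filter-all (x ∷ l) = cong suc (length-filter-all l)

  unique-tabulate⁻ : ∀ {A : Set} {k} (φ : Fin k → A) → Unique (tabulate φ) → Injective _≡_ _≡_ φ
  unique-tabulate⁻ φ (φ0∉ ∷ u) {zero}  {zero}  eq = refl
  unique-tabulate⁻ φ (φ0∉ ∷ u) {zero}  {suc j} eq = contradiction eq (All.tabulate⁻ φ0∉ j)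
  unique-tabulate⁻ φ (φ0∉ ∷ u) {suc i} {zero}  eq = contradiction (sym eq) (All.tabulate⁻ φ0∉ i)
  unique-tabulate⁻ φ (φ0∉ ∷ u) {suc i} {suc j} eq = cong suc (unique-tabulate⁻ (φ ∘ suc) u eq)

  asTabulate : ∀ {A : Set} {k} (l : List A) → length l ≡ k → ∃[ φ ] tabulate {n = k} φ ≡ l
  asTabulate l refl = lookup l , tabulate-lookup l

  BalancedList : ℕ → Colouring n → List (Fin n) → Set
  BalancedList m C l = Unique l × along (R C) l ≡ m × along (B C) l ≡ m

  fromBalancedList : ∀ m (C : Colouring n) (l : List (Fin n)) → length l ≡ suc (2 * m) →
    BalancedList m C l → HasBalancedCopy (path (2 * m)) C
  fromBalancedList m C l len (u , r , b) with asTabulate l len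
  ... | φ , refl = φ , unique-tabulate⁻ φ u , count (R C) r , count (B C) b
    where
    count : ∀ G → along G (tabulate φ) ≡ m → 2 * edgesInto (path (2 * m)) φ G ≡ e (path (2 * m))
    count G eq = trans (cong (2 *_) (trans (edgesInto-path G φ) eq)) (sym (e-path (2 * m)))

  toBalancedList : ∀ m (C : Colouring n) → HasBalancedCopy (path (2 * m)) C →
    ∃[ l ] length l ≡ suc (2 * m) × BalancedList m C l
  toBalancedList m C (φ , inj , r , b) =
    tabulate φ , length-tabulate φ , Unique.tabulate⁺ inj , count (R C) r , count (B C) b
    where
    count : ∀ G → 2 * edgesInto (path (2 * m)) φ G ≡ e (path (2 * m)) → along G (tabulate φ) ≡ m
    count G eq = trans (sym (edgesInto-path G φ)) (*-cancelˡ-≡ _ m 2 (trans eq (e-path (2 * m))))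

  anyOfLength? : {R : Pred (List (Fin n)) 0ℓ} → Decidable R → ∀ k → Dec (∃[ l ] length l ≡ k × R l)
  anyOfLength? R? zero = map′ (λ r → [] , refl , r) (λ { ([] , _ , r) → r }) (R? [])
  anyOfLength? R? (suc k) =
    map′ (λ { (x , l , len , r) → x ∷ l , cong suc len , r })
         (λ { (x ∷ l , len , r) → x , l , suc-injective len , r })
         (any? (λ x → anyOfLength? (λ l → R? (x ∷ l)) k))

  -- `Forces` has to produce a copy, whereas the sliding argument only refutes its absence. A finite
  -- search through all lists of the right length closes the gap.
  hasBalancedCopy? : ∀ m (C : Colouring n) → Dec (HasBalancedCopy (path (2 * m)) C)
  hasBalancedCopy? m C = map′
    (λ (l , len , bal) → fromBalancedList m C l len bal) (toBalancedList m C)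
    (anyOfLength? (λ l → unique? _≟_ l ×-dec (along (R C) l ℕ.≟ m) ×-dec (along (B C) l ℕ.≟ m)) (suc (2 * m)))

-- From the Turán theorem to the balancing number and its extremal family.

module Balance where

  open Counting hiding (P)
  open Forests hiding (m)
  open SplitGraphs
  open Turan
  open Sliding
  open Copies
  open import Data.Fin using (Fin; zero; suc)
  open import Data.Fin.Properties using (_≟_; any?)
  open import Data.List using (List; []; _∷_; length; map)
  open import Data.List.Relation.Unary.All using ([]; _∷_)
  open import Data.List.Relation.Unary.AllPairs using ([]; _∷_)
  open import Data.List.Relation.Unary.Unique.Propositional using (Unique)
  import Data.List.Relation.Unary.Unique.Propositional.Properties as Unique
  open import Data.Nat using (ℕ; zero; suc; _+_; _*_; _≤_; _<_; z≤n; s≤s)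
  open import Data.Nat.Properties hiding (_≟_)
  open import Data.Nat.Tactic.RingSolver using (solve-∀)
  open import Data.Product using (_×_; ∃-syntax; _,_; proj₁; proj₂)
  open import Data.Sum using (_⊎_; inj₁; inj₂)
  import Data.Sum as Sum
  open import Function using (_∘_; _⇔_; mk⇔; Inverse; Injection; Equivalence)
  open import Function.Construct.Identity using (↔-id)
  open import Function.Properties.Inverse using (↔⇒↣)
  open import Level using (0ℓ)
  open import Relation.Binary.PropositionalEquality hiding ([_])
  open import Relation.Nullary using (yes; no; ¬_; contradiction)
  open import Relation.Nullary.Decidable using (_×-dec_; ¬?)
  open import Relation.Unary using (Pred)

  complement : Graph n → Graph n
  complement G = record
    { _~_     = λ u v → u ≢ v × ¬ (G ⊢ u ~ v)
    ; _~?_    = λ u v → ¬? (u ≟ v) ×-dec ¬? (G ⊢ u ~? v)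
    ; ~-sym   = λ (u≢v , ¬uv) → (u≢v ∘ sym) , (¬uv ∘ Graph.~-sym G)
    ; ~-irref = λ (u≢u , _) → u≢u refl
    }

  colouringBy : Graph n → Colouring n
  colouringBy G = record
    { R        = G
    ; B        = complement G
    ; cover    = cover
    ; disjoint = λ (r , (_ , ¬r)) → ¬r r
    }
    where
    cover : ∀ {u v} → u ≢ v → G ⊢ u ~ v ⊎ complement G ⊢ u ~ v
    cover {u} {v} u≢v with G ⊢ u ~? v
    ... | yes u~v = inj₁ u~v
    ... | no ¬u~v = inj₂ (u≢v , ¬u~v)

  e-≅ : {G H : Graph n} → G ≅ H → e G ≡ e H
  e-≅ {G = G} {H} i = *-cancelˡ-≡ (e G) (e H) 2
    (trans (sym (handshake G)) (trans (degreeSum-≅ i) (handshake H)))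

  -- For fixed `v`, each vertex `u` counts exactly once: as a red neighbour, as a blue neighbour, or
  -- as `v` itself.
  e-colours : (C : Colouring n) → 2 * e (R C) + 2 * e (B C) + n ≡ n * n
  e-colours {n} C = begin
    2 * e (R C) + 2 * e (B C) + n
      ≡⟨ cong₂ (λ r b → r + b + n) (handshake (R C)) (handshake (B C)) ⟨
    degreeSum (R C) + degreeSum (B C) + n
      ≡⟨ cong (degreeSum (R C) + degreeSum (B C) +_) (sum-ones n) ⟨
    degreeSum (R C) + degreeSum (B C) + ∑[ v < n ] 1
      ≡⟨ cong (_+ ∑[ v < n ] 1) (∑-distrib-+ (degree (R C)) (degree (B C))) ⟨
    ∑[ v < n ] (degree (R C) v + degree (B C) v) + ∑[ v < n ] 1
      ≡⟨ ∑-distrib-+ (λ v → degree (R C) v + degree (B C) v) (λ _ → 1) ⟨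
    ∑[ v < n ] (degree (R C) v + degree (B C) v + 1)
      ≡⟨ sum-cong-≗ row ⟩
    ∑[ v < n ] n
      ≡⟨ sum-const n n ⟩
    n * n
      ∎
    where
    open ≡-Reasoning
    r b d : Fin n → Fin n → ℕ
    r v u = ⟦ R C ⊢ v ~? u ⟧
    b v u = ⟦ B C ⊢ v ~? u ⟧
    d v u = ⟦ u ≟ v ⟧
    entry : ∀ v u → r v u + b v u + d v u ≡ 1
    entry v u with u ≟ v
    ... | yes refl = cong₂ (λ x y → x + y + 1)
      (⟦⟧-no (R C ⊢ u ~? u) (Graph.~-irref (R C))) (⟦⟧-no (B C ⊢ u ~? u) (Graph.~-irref (B C)))
    ... | no u≢v = trans (+-identityʳ _) (colours C (u≢v ∘ sym))
    row : ∀ v → degree (R C) v + degree (B C) v + 1 ≡ n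
    row v = begin
      degree (R C) v + degree (B C) v + 1             ≡⟨ cong₂ _+_ (∑-distrib-+ (r v) (b v)) (∑-≟ v) ⟨
      ∑[ u < n ] (r v u + b v u) + ∑[ u < n ] d v u   ≡⟨ ∑-distrib-+ (λ u → r v u + b v u) (d v) ⟨
      ∑[ u < n ] (r v u + b v u + d v u)              ≡⟨ sum-cong-≗ (entry v) ⟩
      ∑[ u < n ] 1                                    ≡⟨ sum-ones n ⟩
      n                                               ∎

  ≅-edgeless : {G : Graph n} → (∀ u v → ¬ (G ⊢ u ~ v)) → G ≅ edgeless
  ≅-edgeless none = record { bij = ↔-id _ ; preserve = λ u v → mk⇔ (none u v) λ () }

  -- A red and a blue edge with a common vertex would be a placement with exactly one red edge. So
  -- red spreads from one edge to all edges at `a`, and from there to every edge.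
  monochromatic : (C : Colouring n) → (∀ l → Unique l → length l ≡ 3 → along (R C) l ≢ 1) →
    (∀ u v → ¬ (R C ⊢ u ~ v)) ⊎ (∀ u v → ¬ (B C ⊢ u ~ v))
  monochromatic C avoided with any? (λ u → any? (λ v → R C ⊢ u ~? v))
  ... | no none = inj₁ λ u v u~v → none (u , v , u~v)
  ... | yes (a , b , a~b) = inj₂ λ u v u~v → Colouring.disjoint C (all (≢-of u~v) , u~v)
    where
    ≢-of : ∀ {u v} → B C ⊢ u ~ v → u ≢ v
    ≢-of u~u refl = Graph.~-irref (B C) u~u
    propagate : ∀ {x y z} → R C ⊢ x ~ y → y ≢ z → x ≢ z → R C ⊢ y ~ z
    propagate {x} {y} {z} x~y y≢z x≢z with R C ⊢ y ~? z in eq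
    ... | yes y~z = y~z
    ... | no ¬y~z = contradiction
      (trans (edge⇒along (R C) (z ∷ []) x~y) (cong suc (trans (+-identityʳ _) (⟦⟧-no (R C ⊢ y ~? z) ¬y~z))))
      (avoided (x ∷ y ∷ z ∷ []) (((λ { refl → Graph.~-irref (R C) x~y }) ∷ x≢z ∷ []) ∷ (y≢z ∷ []) ∷ [] ∷ []) refl)
    star : ∀ {u} → a ≢ u → R C ⊢ a ~ u
    star {u} a≢u with b ≟ u
    ... | yes refl = a~b
    ... | no  b≢u  = propagate (Graph.~-sym (R C) a~b) a≢u b≢u
    all : ∀ {u v} → u ≢ v → R C ⊢ u ~ v
    all {u} {v} u≢v with a ≟ u | a ≟ v
    ... | yes refl | _        = star u≢v
    ... | no  a≢u  | yes refl = Graph.~-sym (R C) (star a≢u)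
    ... | no  a≢u  | no a≢v   = propagate (star a≢u) u≢v a≢v

  monochromatic-≅ : ∀ c h {o} → 2 * h + suc c ≡ 1 → (C : Colouring (h + o)) →
    (∀ l → Unique l → length l ≡ suc (2 * (2 * h + suc c)) → along (R C) l ≢ 2 * h + suc c) →
    R C ≅ splitGraph c h o ⊎ B C ≅ splitGraph c h o
  monochromatic-≅ zero    zero    _  C avoided = Sum.map ≅-edgeless ≅-edgeless (monochromatic C avoided)
  monochromatic-≅ (suc c) zero    () C avoided
  monochromatic-≅ c       (suc h) eq C avoided =
    contradiction (trans (sym (+-suc (h + suc (h + 0)) c)) (suc-injective eq)) λ ()

  isBal-unique : ∀ {k} {G : Graph k} {s t} → IsBal n G s → IsBal n G t → s ≡ t
  isBal-unique (forces-s , min-s) (forces-t , min-t) = ≤-antisym (min-s _ forces-t) (min-t _ forces-s)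

  -- `large` feeds the Turán induction, `room` makes the path fit, and `spare` supplies the outside
  -- vertex for sliding except when the path has two edges.
  module Extremality (c h o : ℕ) (c≤1 : c ≤ 1) (2c≤o : 2 * c ≤ o)
    (large : 33 * h + 16 * c ≤ 2 * (h + o) + 9)
    (room : suc (2 * (2 * h + suc c)) ≤ h + o)
    (spare : 2 * h + suc c ≡ 1 ⊎ suc (2 * (2 * h + suc c)) < h + o) where

    N m s : ℕ
    N = h + o
    m = 2 * h + suc c

    S : Graph N
    S = splitGraph c h o

    s = e S

    P : Graph (suc (2 * m))
    P = path (2 * m)

    s-formula : 2 * s + h * suc h ≡ 2 * (h * N) + 2 * c
    s-formula = trans (cong (_+ h * suc h) (sym (handshake S))) (degreeSum-splitGraph c h o c≤1 2c≤o)

    along-≅S : {G : Graph N} → G ≅ S → (l : List (Fin N)) → Unique l → along G l < m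
    along-≅S {G} i l u = begin-strict
      along G l
        ≡⟨ along-map G S (Inverse.to (_≅_.bij i)) (_≅_.preserve i) l ⟨
      along S (map (Inverse.to (_≅_.bij i)) l)
        ≤⟨ along-splitGraph c h o c≤1 _ (Unique.map⁺ (Injection.injective (↔⇒↣ (_≅_.bij i))) u) ⟩
      2 * h + c
        <⟨ ≤-reflexive (sym (+-suc (2 * h) c)) ⟩
      m ∎
      where open ≤-Reasoning

    ≅S⇒noCopy : (C : Colouring N) → R C ≅ S ⊎ B C ≅ S → ¬ HasBalancedCopy P C
    ≅S⇒noCopy C iso copy with toBalancedList m C copy
    ≅S⇒noCopy C (inj₁ i) copy | l , _ , u , r , _ = <⇒≢ (along-≅S i l u) r
    ≅S⇒noCopy C (inj₂ i) copy | l , _ , u , _ , b = <⇒≢ (along-≅S i l u) b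

    enough : (G : Graph N) → s ≤ e G → 2 * (h * N) + 2 * c ≤ degreeSum G + h * suc h
    enough G s≤ = begin
      2 * (h * N) + 2 * c      ≡⟨ s-formula ⟨
      2 * s + h * suc h        ≤⟨ +-monoˡ-≤ (h * suc h) (*-monoʳ-≤ 2 s≤) ⟩
      2 * e G + h * suc h      ≡⟨ cong (_+ h * suc h) (handshake G) ⟨
      degreeSum G + h * suc h  ∎
      where open ≤-Reasoning

    light⇒≅S : (G : Graph N) → s ≤ e G → (∀ l → Unique l → length l ≡ suc (2 * m) → along G l < m) → G ≅ S
    light⇒≅S G s≤ light =
      extremal-≅ c h o c≤1 2c≤o large G (enough G s≤) (light⇒¬Forest G m room light)

    -- The weak inequality serves two purposes: the strict case contradicts the edge count of `S`
    -- and gives `forces`, and the case of equality describes the extremal colourings.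
    noCopy⇒≅S : (C : Colouring N) → s ≤ minColour C → ¬ HasBalancedCopy P C → R C ≅ S ⊎ B C ≅ S
    noCopy⇒≅S C s≤ none = cases spare
      where
      total : ∀ l → Unique l → length l ≡ suc (2 * m) → along (R C) l + along (B C) l ≡ m + m
      total (x ∷ l) u len = trans (along-colours C x l u) (trans (suc-injective len) (cong (m +_) (+-identityʳ m)))
      -- The two colour counts of a list add up to `m + m`, so `m` red edges would already make the
      -- copy balanced.
      avoided : ∀ l → Unique l → length l ≡ suc (2 * m) → along (R C) l ≢ m
      avoided l u len r = none (fromBalancedList m C l len
        (u , r , +-cancelˡ-≡ m _ _ (trans (cong (_+ along (B C) l) (sym r)) (total l u len))))
      cases : m ≡ 1 ⊎ suc (2 * m) < N → R C ≅ S ⊎ B C ≅ S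
      cases (inj₁ m≡1) = monochromatic-≅ c h m≡1 C avoided
      cases (inj₂ K<N) = Sum.map
        (light⇒≅S (R C) (≤-trans s≤ (m⊓n≤m _ _)))
        (λ heavy → light⇒≅S (B C) (≤-trans s≤ (m⊓n≤n (e (R C)) _)) λ l u len →
          +-cancelˡ-< m _ _ (<-≤-trans (+-monoˡ-< _ (heavy l u len)) (≤-reflexive (total l u len))))
        (allLightOrAllHeavy (R C) m (suc (2 * m)) K<N avoided)

    -- By `room`, N(N - 1) is at least 2mN = (4h + 2 + 2c)N, which exceeds 4s ≤ 4hN + 4c by enough.
    -- This makes `S` the minority colour and stops a complement from being isomorphic to `S`.
    s<other : (C : Colouring N) → e (R C) ≡ s → s < e (B C)
    s<other C eR≡s = *-cancelˡ-≤ 2 (≤-from (N + 2 * (h * suc h))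
      (+-mono-≤ (+-mono-≤ (+-mono-≤ total (*-monoʳ-≤ 2 (≤-reflexive s-formula))) (*-monoʳ-≤ (2 * c) 2≤N)) 2≤N)
      (arith h N c s (e (B C))))
      where
      total : suc (2 * m) * N ≤ 2 * s + 2 * e (B C) + N
      total = ≤-trans (*-monoˡ-≤ N room)
        (≤-reflexive (sym (trans (cong (λ x → 2 * x + 2 * e (B C) + N) (sym eR≡s)) (e-colours C))))
      2≤N : 2 ≤ N
      2≤N = ≤-trans (s≤s (≤-trans (≤-trans (s≤s z≤n) (m≤n+m (suc c) (2 * h))) (m≤m+n m (m + 0)))) room
      arith : ∀ h N c s b →
        2 * suc s + (2 * s + 2 * b + N + 2 * (2 * (h * N) + 2 * c) + 2 * c * N + N) + (N + 2 * (h * suc h)) ≡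
        2 * b + (suc (2 * (2 * h + suc c)) * N + 2 * (2 * s + h * suc h) + 2 * c * 2 + 2)
      arith = solve-∀

    minColour-≡s : (G : Graph N) → e G ≡ s → minColour (colouringBy G) ≡ s
    minColour-≡s G eG≡s = trans (m≤n⇒m⊓n≡m (≤-trans (≤-reflexive eG≡s) (<⇒≤ (s<other (colouringBy G) eG≡s)))) eG≡s

    isBal : IsBal N P s
    isBal = forces , minimal
      where
      forces : Forces N P s
      forces C s<min with hasBalancedCopy? m C
      ... | yes copy = copy
      ... | no  none with noCopy⇒≅S C (<⇒≤ s<min) none
      ...   | inj₁ i = contradiction (e-≅ i) (>⇒≢ (<-≤-trans s<min (m⊓n≤m _ _)))
      ...   | inj₂ i = contradiction (e-≅ i) (>⇒≢ (<-≤-trans s<min (m⊓n≤n (e (R C)) _)))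
      minimal : ∀ t → Forces N P t → s ≤ t
      minimal t forces-t = ≮⇒≥ λ t<s → ≅S⇒noCopy (colouringBy S) (inj₁ ≅-refl)
        (forces-t (colouringBy S) (<-≤-trans t<s (≤-reflexive (sym (minColour-≡s S refl)))))

    IsBal⇒≡s : ∀ {t} → IsBal N P t → t ≡ s
    IsBal⇒≡s bal-t = isBal-unique {G = P} bal-t isBal

    module _ {F : Pred (Graph N) 0ℓ} where

      -- Colouring a member of `F` red leaves no copy, so it or its complement is isomorphic to `S`,
      -- and the complement has too many edges. That `F` has a member at all comes from `extremal`,
      -- applied to the colouring by `S`.
      family⇒ : IsBalFamily N P F → ∀ H → F H ⇔ H ≅ S
      family⇒ family H = mk⇔ (F⇒≅S H) ≅S⇒F
        where
        open IsBalFamily family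
        isBal-minColour : (G : Graph N) → e G ≡ s → IsBal N P (minColour (colouringBy G))
        isBal-minColour G eG≡s = subst (IsBal N P) (sym (minColour-≡s G eG≡s)) isBal
        inR : (G : Graph N) → e G ≡ s → G ≅ S ⊎ complement G ≅ S → G ≅ S
        inR G eG≡s (inj₁ i) = i
        inR G eG≡s (inj₂ i) = contradiction (e-≅ i) (>⇒≢ (s<other (colouringBy G) eG≡s))
        F⇒≅S : ∀ G → F G → G ≅ S
        F⇒≅S G FG = inR G eG≡s (noCopy⇒≅S (colouringBy G) (≤-reflexive (sym (minColour-≡s G eG≡s)))
          (Equivalence.from (extremal (colouringBy G) (isBal-minColour G eG≡s)) (G , FG , inj₁ ≅-refl)))
          where
          eG≡s : e G ≡ s
          eG≡s = IsBal⇒≡s (size FG)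
        member : ∃[ K ] F K × (S ≅ K ⊎ complement S ≅ K)
        member = Equivalence.to (extremal (colouringBy S) (isBal-minColour S refl))
          (≅S⇒noCopy (colouringBy S) (inj₁ ≅-refl))
        ≅S⇒F : H ≅ S → F H
        ≅S⇒F H≅S = respects-≅ (≅-trans (F⇒≅S (proj₁ member) (proj₁ (proj₂ member))) (≅-sym H≅S)) (proj₁ (proj₂ member))

      ⇒family : (∀ H → F H ⇔ H ≅ S) → IsBalFamily N P F
      ⇒family F⇔ = record
        { respects-≅ = λ {H} {K} H≅K FH → Equivalence.from (F⇔ K) (≅-trans (≅-sym H≅K) (F⇒ FH))
        ; size       = λ FH → subst (IsBal N P) (sym (e-≅ (F⇒ FH))) isBal
        ; extremal   = λ C bal → mk⇔
            (λ none → S , Equivalence.from (F⇔ S) ≅-refl , noCopy⇒≅S C (≤-reflexive (sym (IsBal⇒≡s bal))) none)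
            (λ (H , FH , iso) → ≅S⇒noCopy C (Sum.map (via FH) (via FH) iso))
        }
        where
        F⇒ : ∀ {H} → F H → H ≅ S
        F⇒ {H} = Equivalence.to (F⇔ H)
        via : ∀ {G H} → F H → G ≅ H → G ≅ S
        via FH i = ≅-trans i (F⇒ FH)

    balIsOnly : BalIsOnly N P S
    balIsOnly F = mk⇔ family⇒ ⇒family

-- The iterated cones satisfy the definition by a vertex partition.

module Shape where

  open Counting
  open SplitGraphs
  open Turan
  open import Data.Empty using (⊥; ⊥-elim)
  open import Data.Fin using (Fin; zero; suc; _↑ʳ_)
  open import Data.Fin.Properties using (suc-injective; ↑ʳ-injective)
  open import Data.Fin.Subset using (Subset; inside; _∈_; ∁; ∣_∣)
  import Data.Fin.Subset as Subset
  open import Data.Nat using (ℕ; zero; suc; _+_; _≤_; z≤n; s≤s)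
  open import Data.Product using (_×_; _,_)
  import Data.Product as Product
  open import Data.Sum using (_⊎_; inj₁; inj₂)
  import Data.Sum as Sum
  open import Data.Unit using (tt)
  open import Data.Vec using (_∷_; here; there)
  open import Function using (_∘_; _⇔_; mk⇔; Equivalence)
  open import Function.Construct.Composition using (_⇔-∘_)
  open import Relation.Binary.PropositionalEquality
  open import Relation.Nullary using (¬_; contradiction)

  core : ∀ h n → Subset (h + n)
  core zero    n = Subset.⊥
  core (suc h) n = inside ∷ core h n

  ∣core∣ : ∀ h n → ∣ core h n ∣ ≡ h
  ∣core∣ zero    zero    = refl
  ∣core∣ zero    (suc n) = ∣core∣ zero n
  ∣core∣ (suc h) n       = cong suc (∣core∣ h n)

  ∣∁core∣ : ∀ h n → ∣ ∁ (core h n) ∣ ≡ n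
  ∣∁core∣ zero    zero    = refl
  ∣∁core∣ zero    (suc n) = cong suc (∣∁core∣ zero n)
  ∣∁core∣ (suc h) n       = ∣∁core∣ h n

  ↑ʳ∈∁core : ∀ h {n} (i : Fin n) → h ↑ʳ i ∈ ∁ (core h n)
  ↑ʳ∈∁core zero    zero    = here
  ↑ʳ∈∁core zero    (suc i) = there (↑ʳ∈∁core zero i)
  ↑ʳ∈∁core (suc h) i       = there (↑ʳ∈∁core h i)

  ∉core₀ : ∀ {n} {u : Fin n} → ¬ (u ∈ core zero n)
  ∉core₀ {suc n} (there u∈) = ∉core₀ u∈

  core-splits : ∀ h n → SplitsAlong (core h n) (splitGraph 0 h n)
  core-splits h n = record { clique = clique h ; independent = independent h ; joined = joined h }
    where
    clique : ∀ h {u v} → u ∈ core h n → v ∈ core h n → u ≢ v → splitGraph 0 h n ⊢ u ~ v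
    clique zero    u∈         _          _   = ⊥-elim (∉core₀ u∈)
    clique (suc h) here       here       u≢v = u≢v refl
    clique (suc h) here       (there _)  _   = tt
    clique (suc h) (there _)  here       _   = tt
    clique (suc h) (there u∈) (there v∈) u≢v = clique h u∈ v∈ (u≢v ∘ cong suc)
    independent : ∀ h {u v} → u ∈ ∁ (core h n) → v ∈ ∁ (core h n) → ¬ (splitGraph 0 h n ⊢ u ~ v)
    independent zero    _          _          ()
    independent (suc h) (there u∈) (there v∈) u~v = independent h u∈ v∈ u~v
    joined : ∀ h {u v} → u ∈ core h n → v ∈ ∁ (core h n) → splitGraph 0 h n ⊢ u ~ v
    joined zero    u∈         _          = ∉core₀ u∈
    joined (suc h) here       (there _)  = tt
    joined (suc h) (there u∈) (there v∈) = joined h u∈ v∈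

  module _ (n : ℕ) where

    IsExtraEdge : ∀ h → (u v : Fin (h + suc (suc n))) → Set
    IsExtraEdge h u v = (u ≡ h ↑ʳ zero × v ≡ h ↑ʳ suc zero) ⊎ (u ≡ h ↑ʳ suc zero × v ≡ h ↑ʳ zero)

    -- The seed edge joins the first two outer vertices, which the `h` apexes shift to `h ↑ʳ zero`
    -- and `h ↑ʳ suc zero`.
    extraEdge : ∀ h u v → splitGraph 1 h (suc (suc n)) ⊢ u ~ v ⇔
      (splitGraph 0 h (suc (suc n)) ⊢ u ~ v ⊎ IsExtraEdge h u v)
    extraEdge zero    u       v       = mk⇔ inj₂ (λ { (inj₁ ()) ; (inj₂ x) → x }) ⇔-∘ singleEdge-⇔
    extraEdge (suc h) zero    zero    = mk⇔ (λ ()) λ { (inj₁ ()) ; (inj₂ (inj₁ ())) ; (inj₂ (inj₂ ())) }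
    extraEdge (suc h) zero    (suc v) = mk⇔ inj₁ (λ _ → tt)
    extraEdge (suc h) (suc u) zero    = mk⇔ inj₁ (λ _ → tt)
    extraEdge (suc h) (suc u) (suc v) = mk⇔
      (Sum.map₂ (Sum.map up up) ∘ Equivalence.to (extraEdge h u v))
      (Equivalence.from (extraEdge h u v) ∘ Sum.map₂ (Sum.map down down))
      where
      up : ∀ {x y} → u ≡ x × v ≡ y → Fin.suc u ≡ suc x × Fin.suc v ≡ suc y
      up = Product.map (cong suc) (cong suc)
      down : ∀ {x y} → Fin.suc u ≡ suc x × Fin.suc v ≡ suc y → u ≡ x × v ≡ y
      down = Product.map suc-injective suc-injective

  splitGraph₀-isCompleteSplit : ∀ h n → IsCompleteSplit h n (splitGraph 0 h n)
  splitGraph₀-isCompleteSplit h n = core h n , ∣core∣ h n , ∣∁core∣ h n , core-splits h n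

  splitGraph₁-isCompleteSplitPlusEdge : ∀ h {n} → 2 ≤ n → IsCompleteSplitPlusEdge h n (splitGraph 1 h n)
  splitGraph₁-isCompleteSplitPlusEdge h {suc (suc n)} (s≤s (s≤s z≤n)) = record
    { X      = core h (suc (suc n))
    ; ∣X∣≡p  = ∣core∣ h (suc (suc n))
    ; ∣Y∣≡q  = ∣∁core∣ h (suc (suc n))
    ; S      = splitGraph 0 h (suc (suc n))
    ; splitS = core-splits h (suc (suc n))
    ; x      = h ↑ʳ zero
    ; y      = h ↑ʳ suc zero
    ; x∈Y    = ↑ʳ∈∁core h zero
    ; y∈Y    = ↑ʳ∈∁core h (suc zero)
    ; x≢y    = λ eq → contradiction (↑ʳ-injective h zero (suc zero) eq) λ ()
    ; adj    = extraEdge n h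
    }

-- Translation between rational formulas and integer identities.

module Rationals where

  open import Data.Integer as ℤ using (ℤ; +_; -[1+_])
  import Data.Integer.Properties as ℤ
  import Data.Integer.Tactic.RingSolver as ℤ-Solver
  open import Data.List using ([]; _∷_)
  open import Data.Nat using (ℕ; suc; _+_; _*_; _^_; _≤_)
  open import Data.Nat.Properties hiding (_≟_)
  open import Data.Nat.Tactic.RingSolver using (solve-∀)
  open import Data.Rational.Unnormalised as ℚᵘ using (*≡*; *≤*; _≃_; _≥_)
  open import Relation.Binary.PropositionalEquality hiding ([_])

  integerBound : ∀ k n → ι n ≥ (+ 9 ℚᵘ./ 32) ℚᵘ.* ι (k ^ 2) ℚᵘ.+ (+ 1 ℚᵘ./ 4) ℚᵘ.* ι k ℚᵘ.+ ι 1 →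
    9 * k ^ 2 + 8 * k + 32 ≤ 32 * n
  -- Unnormalised inequalities are cross-multiplied integer ones. The denominators 32, 4 and 1 give
  -- 128, which is 4 times the 32 wanted, so a factor 4 is cancelled.
  integerBound k n (*≤* p) = ℤ.drop‿+≤+ (subst₂ ℤ._≤_ (sym castˡ) (sym (ℤ.pos-* 32 n))
    (ℤ.*-cancelˡ-≤-pos _ _ (+ 4) (subst₂ ℤ._≤_ (lhs (+ (k ^ 2)) (+ k)) (rhs (+ n)) p)))
    where
    lhs : ∀ K κ → ((+ 9 ℤ.* K ℤ.* + 4 ℤ.+ + 1 ℤ.* κ ℤ.* + 32) ℤ.* + 1 ℤ.+ + 1 ℤ.* + 128) ℤ.* + 1 ≡
      + 4 ℤ.* (+ 9 ℤ.* K ℤ.+ + 8 ℤ.* κ ℤ.+ + 32)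
    lhs = ℤ-Solver.solve-∀
    rhs : ∀ ν → ν ℤ.* + 128 ≡ + 4 ℤ.* (+ 32 ℤ.* ν)
    rhs = ℤ-Solver.solve-∀
    castˡ : + (9 * k ^ 2 + 8 * k + 32) ≡ + 9 ℤ.* + (k ^ 2) ℤ.+ + 8 ℤ.* + k ℤ.+ + 32
    castˡ = cong (ℤ._+ + 32) (cong₂ ℤ._+_ (ℤ.pos-* 9 (k ^ 2)) (ℤ.pos-* 8 k))

  -- 1024 is the denominator that unnormalised arithmetic produces on the right-hand sides of value₂ and value₀.
  value : ∀ c h n s → 2 * s + h * suc h ≡ 2 * (h * n) + 2 * c →
    + 512 ℤ.* (+ 2 ℤ.* (+ h ℤ.* + n) ℤ.+ + 2 ℤ.* + c ℤ.+ ℤ.- (+ h ℤ.* (+ 1 ℤ.+ + h))) ≡ + s ℤ.* + 1024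
  value c h n s eq = trans
    (cong (λ x → + 512 ℤ.* (x ℤ.+ ℤ.- (+ h ℤ.* (+ 1 ℤ.+ + h)))) (sym castEq))
    (cancel (+ h) (+ s))
    where
    castEq : + 2 ℤ.* + s ℤ.+ + h ℤ.* (+ 1 ℤ.+ + h) ≡ + 2 ℤ.* (+ h ℤ.* + n) ℤ.+ + 2 ℤ.* + c
    castEq = trans (sym (cong₂ ℤ._+_ (ℤ.pos-* 2 s) (ℤ.pos-* h (suc h)))) (trans (cong +_ eq)
      (cong₂ ℤ._+_ (trans (ℤ.pos-* 2 (h * n)) (cong (+ 2 ℤ.*_) (ℤ.pos-* h n))) (ℤ.pos-* 2 c)))
    cancel : ∀ H σ → + 512 ℤ.* (+ 2 ℤ.* σ ℤ.+ H ℤ.* (+ 1 ℤ.+ H) ℤ.+ ℤ.- (H ℤ.* (+ 1 ℤ.+ H))) ≡ σ ℤ.* + 1024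
    cancel = ℤ-Solver.solve-∀

  module _ (c h : ℕ) where

    private
      k = 2 * (2 * h + suc c)

    cast-k : + k ≡ + 2 ℤ.* (+ 2 ℤ.* + h ℤ.+ (+ 1 ℤ.+ + c))
    cast-k = trans (ℤ.pos-* 2 (2 * h + suc c)) (cong (λ x → + 2 ℤ.* (x ℤ.+ + suc c)) (ℤ.pos-* 2 h))

    cast-k² : + (k ^ 2) ≡ + k ℤ.* + k
    cast-k² = trans (cong (λ x → + (k * x)) (*-identityʳ k)) (ℤ.pos-* k k)

  -- For k = 4h + 2, k²/32 = h(h + 1)/2 + 1/8: the term 1/8 cancels and hn - h(h + 1)/2 remains.
  value₂ : ∀ h n s → 2 * s + h * suc h ≡ 2 * (h * n) + 0 → let k = 2 * (2 * h + 1) in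
    ι s ≃ (ι k ℚᵘ.- ι 2) ℚᵘ.* (+ 1 ℚᵘ./ 4) ℚᵘ.* ι n ℚᵘ.- (+ (k ^ 2) ℚᵘ./ 32) ℚᵘ.+ (+ 1 ℚᵘ./ 8)
  value₂ h n s eq = *≡* (trans (sym (value 0 h n s eq)) (general (+ h) (+ n) _ _ (cast-k 0 h) (cast-k² 0 h)))
    where
    -- The casts of `k` and `k ^ 2` enter as variables; matching their equations with `refl` turns
    -- them into polynomials in `H` for the solver.
    general : ∀ H ν κ K → κ ≡ + 2 ℤ.* (+ 2 ℤ.* H ℤ.+ (+ 1 ℤ.+ + 0)) → K ≡ κ ℤ.* κ →
      + 512 ℤ.* (+ 2 ℤ.* (H ℤ.* ν) ℤ.+ + 2 ℤ.* + 0 ℤ.+ ℤ.- (H ℤ.* (+ 1 ℤ.+ H))) ≡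
      (((κ ℤ.* + 1 ℤ.+ -[1+ 1 ] ℤ.* + 1) ℤ.* + 1 ℤ.* ν ℤ.* + 32 ℤ.+ ℤ.- K ℤ.* + 4) ℤ.* + 8
        ℤ.+ + 1 ℤ.* + 128) ℤ.* + 1
    general H ν _ _ refl refl = ℤ-Solver.solve (H ∷ ν ∷ [])

  -- For k = 4h + 4, -k²/32 + k/8 = -h(h + 1)/2, and the final 1 is the additional edge.
  value₀ : ∀ h n s → 2 * s + h * suc h ≡ 2 * (h * n) + 2 → let k = 2 * (2 * h + 2) in
    ι s ≃ (ι k ℚᵘ.- ι 4) ℚᵘ.* (+ 1 ℚᵘ./ 4) ℚᵘ.* ι n ℚᵘ.- (+ (k ^ 2) ℚᵘ./ 32) ℚᵘ.+ (+ k ℚᵘ./ 8) ℚᵘ.+ ι 1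
  value₀ h n s eq = *≡* (trans (sym (value 1 h n s eq)) (general (+ h) (+ n) _ _ (cast-k 1 h) (cast-k² 1 h)))
    where
    general : ∀ H ν κ K → κ ≡ + 2 ℤ.* (+ 2 ℤ.* H ℤ.+ (+ 1 ℤ.+ + 1)) → K ≡ κ ℤ.* κ →
      + 512 ℤ.* (+ 2 ℤ.* (H ℤ.* ν) ℤ.+ + 2 ℤ.* + 1 ℤ.+ ℤ.- (H ℤ.* (+ 1 ℤ.+ H))) ≡
      ((((κ ℤ.* + 1 ℤ.+ -[1+ 3 ] ℤ.* + 1) ℤ.* + 1 ℤ.* ν ℤ.* + 32 ℤ.+ ℤ.- K ℤ.* + 4) ℤ.* + 8
        ℤ.+ κ ℤ.* + 128) ℤ.* + 1 ℤ.+ + 1 ℤ.* + 1024) ℤ.* + 1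
    general H ν _ _ refl refl = ℤ-Solver.solve (H ∷ ν ∷ [])

-- Consequences of the lower bound on n, and residues modulo 4.

module Bounds where

  open Forests using (≤-from)
  open import Data.Nat using (zero; suc; _+_; _*_; _^_; _≤_; _<_; z≤n; s≤s; _%_; _/_)
  open import Data.Nat.DivMod using (m≡m%n+[m/n]*n)
  open import Data.Nat.Properties hiding (_≟_; _≤?_)
  open import Data.Nat.Tactic.RingSolver using (solve-∀)
  open import Data.Product using (_×_; ∃-syntax; _,_)
  open import Data.Sum using (_⊎_; inj₁; inj₂)
  open import Relation.Binary.PropositionalEquality hiding ([_])
  open import Relation.Nullary using (contradiction)

  halved : ∀ m n → 9 * (2 * m) ^ 2 + 8 * (2 * m) + 32 ≤ 32 * n → 9 * (m * m) + 4 * m + 8 ≤ 8 * n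
  halved m n bound = *-cancelˡ-≤ 4 (≤-from 0 bound
    (trans (arith m n)
      (cong (λ x → 4 * (8 * n) + (9 * (2 * m * x) + 8 * (2 * m) + 32)) (sym (*-identityʳ (2 * m))))))
    where
    arith : ∀ m n → 4 * (9 * (m * m) + 4 * m + 8) + 32 * n + 0 ≡ 4 * (8 * n) + (9 * (2 * m * (2 * m)) + 8 * (2 * m) + 32)
    arith = solve-∀

  room∧spare : ∀ m n → 1 ≤ m → 9 * (m * m) + 4 * m + 8 ≤ 8 * n →
    suc (2 * m) ≤ n × (m ≡ 1 ⊎ suc (2 * m) < n)
  -- For `m` equal to 1 the bound reads 21 ≤ 8n, that is n ≥ 3. At n = 3 the path covers all
  -- vertices, so the first alternative is returned.
  room∧spare (suc zero) n _ bound =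
    ≰⇒> (λ n≤2 → <⇒≱ {16} {21} (≤ᵇ⇒≤ 17 21 _) (≤-trans bound (*-monoʳ-≤ 8 n≤2))) , inj₁ refl
  room∧spare (suc (suc t)) n _ bound = <⇒≤ spare , inj₂ spare
    where
    spare : suc (2 * suc (suc t)) < n
    spare = *-cancelˡ-≤ 8 (≤-from (9 * (t * t) + 24 * t + 4) bound (arith t n))
      where
      arith : ∀ t n → 8 * suc (suc (2 * suc (suc t))) + 8 * n + (9 * (t * t) + 24 * t + 4) ≡
        8 * n + (9 * (suc (suc t) * suc (suc t)) + 4 * suc (suc t) + 8)
      arith = solve-∀

  -- By the bound, four times the difference of the two sides is at least 36h² - 88h + 57 for c = 0
  -- and 36h² - 52h + 24 for c = 1. Both are positive, but a slack without subtraction needs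
  -- nonnegative coefficients; hence the shifts h = t + 2 and h = t + 1, with smaller h treated
  -- apart.
  enoughVertices : ∀ c h n → c ≤ 1 → let m = 2 * h + suc c in
    9 * (m * m) + 4 * m + 8 ≤ 8 * n → 33 * h + 16 * c ≤ 2 * n + 9
  enoughVertices c h n c≤1 bound = *-cancelˡ-≤ 4 (large c h c≤1 bound)
    where
    large : ∀ c h → c ≤ 1 → let m = 2 * h + suc c in
      9 * (m * m) + 4 * m + 8 ≤ 8 * n → 4 * (33 * h + 16 * c) ≤ 4 * (2 * n + 9)
    large zero zero _ bound = z≤n
    large zero (suc zero) _ bound = ≤-from 5 bound (arith n)
      where
      arith : ∀ n → 132 + 8 * n + 5 ≡ 4 * (2 * n + 9) + 101
      arith = solve-∀
    large zero (suc (suc t)) _ bound = ≤-from (36 * (t * t) + 56 * t + 25) bound (arith n t)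
      where
      arith : ∀ n t → 4 * (33 * suc (suc t) + 16 * 0) + 8 * n + (36 * (t * t) + 56 * t + 25) ≡
        4 * (2 * n + 9) + (9 * ((2 * suc (suc t) + 1) * (2 * suc (suc t) + 1)) + 4 * (2 * suc (suc t) + 1) + 8)
      arith = solve-∀
    large (suc zero) zero _ bound = ≤-from 24 bound (arith n)
      where
      arith : ∀ n → 64 + 8 * n + 24 ≡ 4 * (2 * n + 9) + 52
      arith = solve-∀
    large (suc zero) (suc t) _ bound = ≤-from (36 * (t * t) + 20 * t + 8) bound (arith n t)
      where
      arith : ∀ n t → 4 * (33 * suc t + 16 * 1) + 8 * n + (36 * (t * t) + 20 * t + 8) ≡
        4 * (2 * n + 9) + (9 * ((2 * suc t + 2) * (2 * suc t + 2)) + 4 * (2 * suc t + 2) + 8)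
      arith = solve-∀
    large (suc (suc c)) h (s≤s ()) bound

  remaining : ∀ c h o → suc (2 * (2 * h + suc c)) ≤ h + o → 2 * c ≤ o
  remaining c h o room = +-cancelˡ-≤ h (2 * c) o (≤-from (3 * h + 3) room (arith c h o))
    where
    arith : ∀ c h o → h + 2 * c + (h + o) + (3 * h + 3) ≡ h + o + suc (2 * (2 * h + suc c))
    arith = solve-∀

  core≤ : ∀ c h n → suc (2 * (2 * h + suc c)) ≤ n → h ≤ n
  core≤ c h n room = ≤-from (3 * h + 2 * c + 3) room (arith c h n)
    where
    arith : ∀ c h n → h + n + (3 * h + 2 * c + 3) ≡ n + suc (2 * (2 * h + suc c))
    arith = solve-∀

  ≡2mod4 : ∀ k → k % 4 ≡ 2 → ∃[ h ] k ≡ 2 * (2 * h + 1)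
  ≡2mod4 k k%4≡2 = k / 4 , trans (m≡m%n+[m/n]*n k 4) (trans (cong (_+ k / 4 * 4) k%4≡2) (arith (k / 4)))
    where
    arith : ∀ q → 2 + q * 4 ≡ 2 * (2 * q + 1)
    arith = solve-∀

  ≡0mod4 : ∀ k → 2 ≤ k → k % 4 ≡ 0 → ∃[ h ] k ≡ 2 * (2 * h + 2)
  ≡0mod4 k 2≤k k%4≡0 with k / 4 in eq
  -- A zero quotient would make `k` zero. Otherwise `h` is one less than the quotient, since 2(2h +
  -- 2) = 4(h + 1).
  ... | zero  = contradiction (trans (m≡m%n+[m/n]*n k 4) (cong₂ (λ r q → r + q * 4) k%4≡0 eq))
    (>⇒≢ (<-≤-trans (s≤s z≤n) 2≤k))
  ... | suc h = h , trans (m≡m%n+[m/n]*n k 4) (trans (cong₂ (λ r q → r + q * 4) k%4≡0 eq) (arith h))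
    where
    arith : ∀ q → 0 + suc q * 4 ≡ 2 * (2 * q + 2)
    arith = solve-∀

-- Assembling the two residue classes.

module Cases where

  open SplitGraphs
  open Shape
  open Balance
  open Rationals
  open Bounds
  open import Data.Integer using (+_)
  open import Data.Nat using (ℕ; suc; _+_; _*_; _∸_; _/_; _^_; _≤_; _<_; z≤n; s≤s)
  open import Data.Nat.DivMod using (m*n/n≡m)
  open import Data.Nat.Properties hiding (_≟_)
  open import Data.Nat.Tactic.RingSolver using (solve-∀)
  open import Data.Product using (_×_; ∃-syntax; _,_; proj₁; proj₂)
  open import Data.Rational.Unnormalised as ℚᵘ using (_≃_)
  open import Data.Sum using (_⊎_)
  open import Relation.Binary.PropositionalEquality hiding ([_])

  Large : ℕ → ℕ → Set
  Large k n = 9 * k ^ 2 + 8 * k + 32 ≤ 32 * n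

  module Parameters (c h n : ℕ) (c≤1 : c ≤ 1) (bound : Large (2 * (2 * h + suc c)) n) where

    private
      m = 2 * h + suc c

      bound′ : 9 * (m * m) + 4 * m + 8 ≤ 8 * n
      bound′ = halved m n bound

      room×spare : suc (2 * m) ≤ n × (m ≡ 1 ⊎ suc (2 * m) < n)
      room×spare = room∧spare m n (≤-trans (s≤s z≤n) (m≤n+m (suc c) (2 * h))) bound′

    room : suc (2 * m) ≤ n
    room = proj₁ room×spare

    spare : m ≡ 1 ⊎ suc (2 * m) < n
    spare = proj₂ room×spare

    manyVertices : 33 * h + 16 * c ≤ 2 * n + 9
    manyVertices = enoughVertices c h n c≤1 bound′

    -- The split graphs live on `h + o` vertices, so `n` must be brought into this form before
    -- `Extremality` can be instantiated.
    outer : ∃[ o ] h + o ≡ n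
    outer = m≤n⇒∃[o]m+o≡n (core≤ c h n room)

  quarter : ∀ h r → (r + h * 4 ∸ r) / 4 ≡ h
  quarter h r = trans (cong (_/ 4) (m+n∸m≡n r (h * 4))) (m*n/n≡m h 4)

  Conclusion₂ : ℕ → ℕ → Set₁
  Conclusion₂ k n =
    (∃[ s ] IsBal n (path k) s
       × ι s ≃ (ι k ℚᵘ.- ι 2) ℚᵘ.* (+ 1 ℚᵘ./ 4) ℚᵘ.* ι n ℚᵘ.- (+ (k ^ 2) ℚᵘ./ 32) ℚᵘ.+ (+ 1 ℚᵘ./ 8))
    × (∃[ S ] IsCompleteSplit ((k ∸ 2) / 4) (n ∸ (k ∸ 2) / 4) S
       × BalIsOnly n (path k) S)

  Conclusion₀ : ℕ → ℕ → Set₁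
  Conclusion₀ k n =
    (∃[ s ] IsBal n (path k) s
       × ι s ≃ (ι k ℚᵘ.- ι 4) ℚᵘ.* (+ 1 ℚᵘ./ 4) ℚᵘ.* ι n ℚᵘ.- (+ (k ^ 2) ℚᵘ./ 32) ℚᵘ.+ (+ k ℚᵘ./ 8) ℚᵘ.+ ι 1)
    × (∃[ S ] IsCompleteSplitPlusEdge ((k ∸ 4) / 4) (n ∸ (k ∸ 4) / 4) S
       × BalIsOnly n (path k) S)

  split₂ : ∀ h {o n} → h + o ≡ n → Large (2 * (2 * h + 1)) n → Conclusion₂ (2 * (2 * h + 1)) n
  split₂ h {o} refl bound =
    (s , isBal , value₂ h (h + o) s s-formula) ,
    (S , subst₂ (λ p q → IsCompleteSplit p q S) (sym h≡) (sym o≡) (splitGraph₀-isCompleteSplit h o) , balIsOnly)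
    where
    open Parameters 0 h (h + o) z≤n bound
    open Extremality 0 h o z≤n z≤n manyVertices room spare
    k = 2 * (2 * h + 1)
    h≡ : (k ∸ 2) / 4 ≡ h
    h≡ = trans (cong (λ k → (k ∸ 2) / 4) (arith h)) (quarter h 2)
      where
      arith : ∀ h → 2 * (2 * h + 1) ≡ 2 + h * 4
      arith = solve-∀
    o≡ : h + o ∸ (k ∸ 2) / 4 ≡ o
    o≡ = trans (cong (h + o ∸_) h≡) (m+n∸m≡n h o)

  split₀ : ∀ h {o n} → h + o ≡ n → Large (2 * (2 * h + 2)) n → Conclusion₀ (2 * (2 * h + 2)) n
  split₀ h {o} refl bound =
    (s , isBal , value₀ h (h + o) s s-formula) ,
    (S , subst₂ (λ p q → IsCompleteSplitPlusEdge p q S) (sym h≡) (sym o≡)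
           (splitGraph₁-isCompleteSplitPlusEdge h 2≤o) , balIsOnly)
    where
    open Parameters 1 h (h + o) ≤-refl bound
    2≤o : 2 ≤ o
    2≤o = remaining 1 h o room
    open Extremality 1 h o ≤-refl 2≤o manyVertices room spare
    k = 2 * (2 * h + 2)
    h≡ : (k ∸ 4) / 4 ≡ h
    h≡ = trans (cong (λ k → (k ∸ 4) / 4) (arith h)) (quarter h 4)
      where
      arith : ∀ h → 2 * (2 * h + 2) ≡ 4 + h * 4
      arith = solve-∀
    o≡ : h + o ∸ (k ∸ 4) / 4 ≡ o
    o≡ = trans (cong (h + o ∸_) h≡) (m+n∸m≡n h o)

  mod₂ : ∀ {k n} → ∃[ h ] k ≡ 2 * (2 * h + 1) → Large k n → Conclusion₂ k n
  mod₂ {n = n} (h , refl) bound = split₂ h (proj₂ (Parameters.outer 0 h n z≤n bound)) bound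

  mod₀ : ∀ {k n} → ∃[ h ] k ≡ 2 * (2 * h + 2) → Large k n → Conclusion₀ k n
  mod₀ {n = n} (h , refl) bound = split₀ h (proj₂ (Parameters.outer 1 h n ≤-refl bound)) bound
open Rationals using (integerBound)
open Bounds using (≡2mod4; ≡0mod4)
open Cases using (mod₂; mod₀)
open import Data.Integer using (+_)
open import Data.Nat using (ℕ; _∸_; _/_; _%_; _≤_; _^_)
open import Data.Nat.Divisibility using (_∣_)
open import Data.Product using (_×_; ∃-syntax; _,_)
open import Data.Rational.Unnormalised as ℚᵘ using (_≃_; _≥_; _+_; _-_; _*_)
open import Relation.Binary.PropositionalEquality using (_≡_)

theorem3p3 : (k n : ℕ) → 2 ≤ k → 2 ∣ k →
    ι n ≥ (+ 9 ℚᵘ./ 32) * ι (k ^ 2) + (+ 1 ℚᵘ./ 4) * ι k + ι 1 →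
    (k % 4 ≡ 2 →
    (∃[ s ] IsBal n (path k) s
    × ι s ≃ (ι k - ι 2) * (+ 1 ℚᵘ./ 4) * ι n - (+ (k ^ 2) ℚᵘ./ 32) + (+ 1 ℚᵘ./ 8))
    × (∃[ S ] IsCompleteSplit ((k ∸ 2) / 4) (n ∸ (k ∸ 2) / 4) S
    × BalIsOnly n (path k) S))
    × (k % 4 ≡ 0 →
    (∃[ s ] IsBal n (path k) s
    × ι s ≃ (ι k - ι 4) * (+ 1 ℚᵘ./ 4) * ι n - (+ (k ^ 2) ℚᵘ./ 32) + (+ k ℚᵘ./ 8) + ι 1)
    × (∃[ S ] IsCompleteSplitPlusEdge ((k ∸ 4) / 4) (n ∸ (k ∸ 4) / 4) S
    × BalIsOnly n (path k) S))
theorem3p3 k n 2≤k _ n-large =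
  (λ k%4≡2 → mod₂ (≡2mod4 k k%4≡2) (integerBound k n n-large)) ,
  (λ k%4≡0 → mod₀ (≡0mod4 k 2≤k k%4≡0) (integerBound k n n-large))
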